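{- There exist absolute constants $c>0$ and $C>0$ such that for every integer $n\ge 3$ there is an integer $k$ with $c\,\frac{\log n}{\log\log n}\le k\le n$ for which the following holds. Let $N$ be a positive integer and suppose that each of the numbers $1,2,\ldots,N$ has one of $n$ colours assigned to it, in such a way that there are no monochromatic solutions to the equation $$x_1+x_2+\cdots+x_{12}=y_1+y_2+\cdots+y_{9}.$$ Then $N\le C\sqrt{(n-k)!}$.
   Context: A monochromatic solution of an equation, with respect to a colouring of $\{1,\ldots,N\}$, is an assignment of values in $\{1,\ldots,N\}$, all of the same colour, to the variables such that the equation holds; the values of the variables need not be distinct. Here $\log$ denotes the natural logarithm. -}

module Defs where

open import Data.Nat as ℕ using (ℕ; zero; suc)
import Data.Nat.Properties as ℕ
open import Data.Integer as ℤ using (ℤ; +_)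
import Data.Integer.Properties as ℤ
open import Data.Rational
import Data.Rational.Unnormalised as ℚᵘ
import Data.Rational.Unnormalised.Properties as ℚᵘ
open import Data.Rational.Properties
open import Data.Rational.Solver
open +-*-Solver using (solve; _:=_; _:+_; _:*_; _:-_; :-_; con)
open import Data.Fin as Fin using (Fin)
open import Data.Vec as Vec using (Vec)
open import Data.Vec.Relation.Unary.All using (All)
open import Data.Product using (∃-syntax; _×_; _,_; proj₁; proj₂)
open import Data.Sum using (inj₁; inj₂)
open import Data.Empty using (⊥-elim)
open import Relation.Nullary using (yes; no)
open import Relation.Nullary.Decidable using (from-yes)
open import Relation.Binary.PropositionalEquality

2ℚ : ℚ
2ℚ = + 2 / 1

0<1 : 0ℚ < 1ℚ
0<1 = from-yes (0ℚ <? 1ℚ)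

0≤1 : 0ℚ ≤ 1ℚ
0≤1 = from-yes (0ℚ ≤? 1ℚ)

0<½ : 0ℚ < ½
0<½ = from-yes (0ℚ <? ½)

0<2 : 0ℚ < 2ℚ
0<2 = from-yes (0ℚ <? 2ℚ)

0≤* : ∀ {p q} → 0ℚ ≤ p → 0ℚ ≤ q → 0ℚ ≤ p * q
0≤* {p} {q} a b = nonNegative⁻¹ (p * q)
  {{nonNeg*nonNeg⇒nonNeg p {{nonNegative a}} q {{nonNegative b}}}}

0<* : ∀ {p q} → 0ℚ < p → 0ℚ < q → 0ℚ < p * q
0<* {p} {q} a b = positive⁻¹ (p * q) {{pos*pos⇒pos p {{positive a}} q {{positive b}}}}

0≤+ : ∀ {p q} → 0ℚ ≤ p → 0ℚ ≤ q → 0ℚ ≤ p + q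
0≤+ {p} {q} a b = nonNegative⁻¹ (p + q)
  {{nonNeg+nonNeg⇒nonNeg p {{nonNegative a}} q {{nonNegative b}}}}

0<+ : ∀ {p q} → 0ℚ < p → 0ℚ < q → 0ℚ < p + q
0<+ {p} {q} a b = positive⁻¹ (p + q) {{pos+pos⇒pos p {{positive a}} q {{positive b}}}}

0<+≤ : ∀ {p q} → 0ℚ < p → 0ℚ ≤ q → 0ℚ < p + q
0<+≤ {p} {q} a b = positive⁻¹ (p + q) {{pos+nonNeg⇒pos p {{positive a}} q {{nonNegative b}}}}

0≤sq : ∀ p → 0ℚ ≤ p * p
0≤sq p with ≤-total 0ℚ p
... | inj₁ h = 0≤* h h
... | inj₂ h = subst (0ℚ ≤_) (solve 1 (λ p → (:- p) :* (:- p) := p :* p) refl p)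
                     (0≤* (neg-antimono-≤ h) (neg-antimono-≤ h))

*-mono₂ : ∀ {p q r s} → 0ℚ ≤ p → p ≤ q → 0ℚ ≤ r → r ≤ s → p * r ≤ q * s
*-mono₂ {p} {q} {r} {s} 0≤p p≤q 0≤r r≤s =
  ≤-trans (*-monoʳ-≤-nonNeg r {{nonNegative 0≤r}} p≤q)
          (*-monoˡ-≤-nonNeg q {{nonNegative (≤-trans 0≤p p≤q)}} r≤s)

≤-diff : ∀ {p q} d → 0ℚ ≤ d → q ≡ p + d → p ≤ q
≤-diff {p} d h e =
  subst₂ _≤_ (+-identityʳ p) (sym e) (+-monoʳ-≤ p h)

diff-≤ : ∀ {p q} → p ≤ q → 0ℚ ≤ q - p
diff-≤ {p} {q} h = subst (_≤ q - p) (+-inverseʳ p) (+-monoˡ-≤ (- p) h)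

-≤⇒≤+ : ∀ {p q e} → p - q ≤ e → p ≤ q + e
-≤⇒≤+ {p} {q} h =
  subst (_≤ _) (solve 2 (λ p q → q :+ (p :- q) := p) refl p q) (+-monoʳ-≤ q h)

≤+⇒-≤ : ∀ {p q e} → p ≤ q + e → p - q ≤ e
≤+⇒-≤ {p} {q} {e} h =
  subst (p - q ≤_) (solve 2 (λ q e → (q :+ e) :- q := e) refl q e) (+-monoˡ-≤ (- q) h)

≤∣∣ : ∀ p → p ≤ ∣ p ∣
≤∣∣ p with ≤-total 0ℚ p
... | inj₁ h = ≤-reflexive (sym (0≤p⇒∣p∣≡p h))
... | inj₂ h = ≤-trans h (0≤∣p∣ p)

∣∣-elim : ∀ {p q e} → ∣ p - q ∣ ≤ e → p ≤ q + e
∣∣-elim h = -≤⇒≤+ (≤-trans (≤∣∣ _) h)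

∣-∣-comm : ∀ p q → ∣ p - q ∣ ≡ ∣ q - p ∣
∣-∣-comm p q = trans (sym (∣-p∣≡∣p∣ (p - q)))
  (cong ∣_∣ (solve 2 (λ p q → :- (p :- q) := q :- p) refl p q))

∣∣-intro : ∀ {p q e} → p ≤ q + e → q ≤ p + e → ∣ p - q ∣ ≤ e
∣∣-intro {p} {q} {e} h k with ∣p∣≡p∨∣p∣≡-p (p - q)
... | inj₁ eq = subst (_≤ e) (sym eq) (≤+⇒-≤ h)
... | inj₂ eq = subst (_≤ e) (sym (trans eq (solve 2 (λ p q → :- (p :- q) := q :- p) refl p q)))
                      (≤+⇒-≤ k)

∣*∣-≤ : ∀ {p q d e} → ∣ p ∣ ≤ d → ∣ q ∣ ≤ e → ∣ p * q ∣ ≤ d * e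
∣*∣-≤ {p} {q} h k = subst (_≤ _) (sym (∣p*q∣≡∣p∣*∣q∣ p q)) (*-mono₂ (0≤∣p∣ p) h (0≤∣p∣ q) k)

mod₁ : ∀ {x y e} A → e ≡ 1ℚ → x ≡ y + A * (e - 1ℚ) → x ≡ y
mod₁ {x} {y} A refl h = trans h (solve 2 (λ y A → y :+ A :* (con 1ℚ :- con 1ℚ) := y) refl y A)

mod₂ : ∀ {x y e f} A B → e ≡ 1ℚ → f ≡ 1ℚ → x ≡ y + A * (e - 1ℚ) + B * (f - 1ℚ) → x ≡ y
mod₂ A B p q h = mod₁ A p (mod₁ B q h)

-- Total, with the junk value recip 0 = 0.
recip : ℚ → ℚ
recip p with p ≟ 0ℚ
... | yes _  = 0ℚ
... | no p≢0 = 1/_ p {{≢-nonZero p≢0}}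

*-recip : ∀ {p} → 0ℚ < p → p * recip p ≡ 1ℚ
*-recip {p} 0<p with p ≟ 0ℚ
... | yes refl = ⊥-elim (<-irrefl refl 0<p)
... | no p≢0   = *-inverseʳ p {{≢-nonZero p≢0}}

recip-pos : ∀ {p} → 0ℚ < p → 0ℚ < recip p
recip-pos {p} 0<p = *-cancelˡ-<-nonNeg p {{nonNegative (<⇒≤ 0<p)}}
  (subst₂ _<_ (sym (*-zeroʳ p)) (sym (*-recip 0<p)) 0<1)

recip-nonNeg : ∀ {p} → 0ℚ < p → 0ℚ ≤ recip p
recip-nonNeg h = <⇒≤ (recip-pos h)

recip-unique : ∀ {p q} → 0ℚ < p → p * q ≡ 1ℚ → recip p ≡ q
recip-unique {p} {q} 0<p e = mod₂ q (- recip p) (*-recip 0<p) e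
  (solve 3 (λ p q u → u := q :+ q :* (p :* u :- con 1ℚ) :+ (:- u) :* (p :* q :- con 1ℚ))
     refl p q (recip p))

recip-diff : ∀ {p q} → 0ℚ < p → 0ℚ < q → recip p - recip q ≡ (q - p) * (recip p * recip q)
recip-diff {p} {q} 0<p 0<q = mod₂ (recip q) (- recip p) (*-recip 0<p) (*-recip 0<q)
  (solve 4 (λ p q u v → u :- v := (q :- p) :* (u :* v)
      :+ v :* (p :* u :- con 1ℚ) :+ (:- u) :* (q :* v :- con 1ℚ))
     refl p q (recip p) (recip q))

recip-anti : ∀ {p q} → 0ℚ < p → p ≤ q → recip q ≤ recip p
recip-anti {p} {q} 0<p p≤q = ≤-diff (recip p - recip q)
  (subst (0ℚ ≤_) (sym (recip-diff 0<p 0<q))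
     (0≤* (diff-≤ p≤q) (0≤* (recip-nonNeg 0<p) (recip-nonNeg 0<q))))
  (solve 2 (λ u v → u := v :+ (u :- v)) refl (recip p) (recip q))
  where 0<q = <-≤-trans 0<p p≤q

ι : ℕ → ℚ
ι n = + n / 1

private
  ιᵘ : ∀ n → toℚᵘ (ι n) ℚᵘ.≃ ℚᵘ.mkℚᵘ (+ n) 0
  ιᵘ n = toℚᵘ-fromℚᵘ (ℚᵘ.mkℚᵘ (+ n) 0)

ι-mono : ∀ {m n} → m ℕ.≤ n → ι m ≤ ι n
ι-mono {m} {n} h = toℚᵘ-cancel-≤
  (ℚᵘ.≤-respˡ-≃ (ℚᵘ.≃-sym (ιᵘ m)) (ℚᵘ.≤-respʳ-≃ (ℚᵘ.≃-sym (ιᵘ n))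
    (ℚᵘ.*≤* (ℤ.*-monoʳ-≤-nonNeg (+ 1) (ℤ.+≤+ h)))))

ι-* : ∀ m n → ι (m ℕ.* n) ≡ ι m * ι n
ι-* m n = toℚᵘ-injective (ℚᵘ.≃-trans (ιᵘ (m ℕ.* n)) (ℚᵘ.≃-sym
  (ℚᵘ.≃-trans (toℚᵘ-homo-* (ι m) (ι n)) (ℚᵘ.≃-trans (ℚᵘ.*-cong (ιᵘ m) (ιᵘ n))
    (ℚᵘ.*≡* (cong (ℤ._* + 1) (sym (ℤ.pos-* m n))))))))

ι-suc : ∀ n → ι (suc n) ≡ ι n + 1ℚ
ι-suc n = toℚᵘ-injective (ℚᵘ.≃-trans (ιᵘ (suc n)) (ℚᵘ.≃-sym
  (ℚᵘ.≃-trans (toℚᵘ-homo-+ (ι n) 1ℚ) (ℚᵘ.≃-trans (ℚᵘ.+-congˡ (toℚᵘ 1ℚ) (ιᵘ n))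
    (ℚᵘ.*≡* (cong (ℤ._* + 1) eq))))))
  where
  eq : + n ℤ.* + 1 ℤ.+ + 1 ℤ.* + 1 ≡ + suc n
  eq = trans (cong (ℤ._+ + 1) (ℤ.*-identityʳ (+ n))) (cong +_ (ℕ.+-comm n 1))

0≤ι : ∀ n → 0ℚ ≤ ι n
0≤ι n = ι-mono {0} {n} ℕ.z≤n

0<ι : ∀ n → 0ℚ < ι (suc n)
0<ι n = <-≤-trans 0<1 (ι-mono {1} {suc n} (ℕ.s≤s ℕ.z≤n))

archimedean : ∀ p → ∃[ n ] p ≤ ι n
archimedean p@(mkℚ z d _) = ℤ.∣ z ∣ , toℚᵘ-cancel-≤
  (ℚᵘ.≤-respʳ-≃ (ℚᵘ.≃-sym (ιᵘ ℤ.∣ z ∣)) (ℚᵘ.*≤* le))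
  where
  z≤∣z∣ : ∀ z → z ℤ.≤ + ℤ.∣ z ∣
  z≤∣z∣ (+ n)      = ℤ.≤-refl
  z≤∣z∣ ℤ.-[1+ n ] = ℤ.-≤+
  le : z ℤ.* + 1 ℤ.≤ + ℤ.∣ z ∣ ℤ.* + suc d
  le = ℤ.≤-trans (ℤ.≤-reflexive (ℤ.*-identityʳ z)) (ℤ.≤-trans (z≤∣z∣ z)
    (subst (+ ℤ.∣ z ∣ ℤ.≤_) (ℤ.pos-* ℤ.∣ z ∣ (suc d))
      (ℤ.+≤+ (ℕ.m≤m*n ℤ.∣ z ∣ (suc d)))))

archimedean-ε : ∀ p {ε} → 0ℚ < ε → ∃[ n ] p ≤ ε * ι n
archimedean-ε p {ε} 0<ε = let (n , h) = archimedean (p * recip ε) in n , subst (_≤ ε * ι n)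
  (mod₁ p (*-recip 0<ε)
    (solve 3 (λ p e u → e :* (p :* u) := p :+ p :* (e :* u :- con 1ℚ)) refl p ε (recip ε)))
  (*-monoˡ-≤-nonNeg ε {{nonNegative (<⇒≤ 0<ε)}} h)

half^ : ℕ → ℚ
half^ zero    = 1ℚ
half^ (suc n) = ½ * half^ n

0≤half^ : ∀ n → 0ℚ ≤ half^ n
0≤half^ zero    = 0≤1
0≤half^ (suc n) = 0≤* (<⇒≤ 0<½) (0≤half^ n)

half^≤1 : ∀ n → half^ n ≤ 1ℚ
half^≤1 zero    = ≤-refl
half^≤1 (suc n) = *-mono₂ (<⇒≤ 0<½) (from-yes (½ ≤? 1ℚ)) (0≤half^ n) (half^≤1 n)

ι*half^≤1 : ∀ n → ι n * half^ n ≤ 1ℚ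
ι*half^≤1 zero    = from-yes (ι 0 * half^ 0 ≤? 1ℚ)
ι*half^≤1 (suc n) = subst (_≤ 1ℚ)
  (sym (trans (cong (_* half^ (suc n)) (ι-suc n))
    (solve 2 (λ i h → (i :+ con 1ℚ) :* (con ½ :* h) := con ½ :* (i :* h) :+ con ½ :* h)
       refl (ι n) (half^ n))))
  (+-mono-≤ (*-monoˡ-≤-nonNeg ½ (ι*half^≤1 n)) (*-monoˡ-≤-nonNeg ½ (half^≤1 n)))

record ℝ : Set where
  constructor mkℝ
  field
    seq    : ℕ → ℚ
    cauchy : ∀ ε → 0ℚ < ε →
             ∃[ K ] (∀ m n → K ℕ.≤ m → K ℕ.≤ n → ∣ seq m - seq n ∣ ≤ ε)

open ℝ

infix  4 _≤ℝ_ _<ℝ_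
infixl 7 _*ℝ_ _/ℝ_[_]

_≤ℝ_ : ℝ → ℝ → Set
x ≤ℝ y = ∀ ε → 0ℚ < ε → ∃[ K ] (∀ n → K ℕ.≤ n → seq x n ≤ seq y n + ε)

_<ℝ_ : ℝ → ℝ → Set
x <ℝ y = ∃[ ε ] 0ℚ < ε × ∃[ K ] (∀ n → K ℕ.≤ n → seq x n + ε ≤ seq y n)

fromℚ : ℚ → ℝ
fromℚ q = mkℝ (λ _ → q) λ ε 0<ε → 0 , λ _ _ _ _ →
  subst (_≤ ε) (sym (cong ∣_∣ (+-inverseʳ q))) (<⇒≤ 0<ε)

fromℕ : ℕ → ℝ
fromℕ n = fromℚ (ι n)

0ℝ 1ℝ : ℝ
0ℝ = fromℚ 0ℚ
1ℝ = fromℚ 1ℚ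

private
  ⊔ˡ : ∀ {k l n} → k ℕ.⊔ l ℕ.≤ n → k ℕ.≤ n
  ⊔ˡ {k} {l} h = ℕ.≤-trans (ℕ.m≤m⊔n k l) h

  ⊔ʳ : ∀ {k l n} → k ℕ.⊔ l ℕ.≤ n → l ℕ.≤ n
  ⊔ʳ {k} {l} h = ℕ.≤-trans (ℕ.m≤n⊔m k l) h

  ∣a∣≤∣a-b∣+∣b∣ : ∀ a b → ∣ a ∣ ≤ ∣ a - b ∣ + ∣ b ∣
  ∣a∣≤∣a-b∣+∣b∣ a b = subst (λ z → ∣ z ∣ ≤ ∣ a - b ∣ + ∣ b ∣) eq (∣p+q∣≤∣p∣+∣q∣ (a - b) b)
    where
    eq : (a - b) + b ≡ a
    eq = solve 2 (λ a b → (a :- b) :+ b := a) refl a b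

  ∣ab-cd∣≤ : ∀ a b c d {A η ζ D} → ∣ a ∣ ≤ A → ∣ c - d ∣ ≤ η → ∣ a - b ∣ ≤ ζ → ∣ d ∣ ≤ D →
             ∣ a * c - b * d ∣ ≤ A * η + ζ * D
  ∣ab-cd∣≤ a b c d {A} {η} {ζ} {D} ha hη hζ hd =
    subst (λ z → ∣ z ∣ ≤ A * η + ζ * D) eq
      (≤-trans (∣p+q∣≤∣p∣+∣q∣ (a * (c - d)) ((a - b) * d))
        (+-mono-≤ (∣*∣-≤ {a} {c - d} ha hη) (∣*∣-≤ {a - b} {d} hζ hd)))
    where
    eq : a * (c - d) + (a - b) * d ≡ a * c - b * d
    eq = solve 4 (λ a b c d → a :* (c :- d) :+ (a :- b) :* d := a :* c :- b :* d) refl a b c d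

  split-ε : ∀ B C ε → 0ℚ < B + C →
            B * (ε * recip (B + C)) + (ε * recip (B + C)) * C ≡ ε
  split-ε B C ε h = mod₁ ε (*-recip h)
    (solve 4 (λ B C e u → B :* (e :* u) :+ (e :* u) :* C
        := e :+ e :* ((B :+ C) :* u :- con 1ℚ)) refl B C ε (recip (B + C)))

  recip-ε : ∀ δ ε → 0ℚ < δ → (ε * (δ * δ)) * (recip δ * recip δ) ≡ ε
  recip-ε δ ε h = mod₁ (ε * (1ℚ + δ * recip δ)) (*-recip h)
    (solve 3 (λ e d u → (e :* (d :* d)) :* (u :* u)
        := e :+ (e :* (con 1ℚ :+ d :* u)) :* (d :* u :- con 1ℚ)) refl ε δ (recip δ))

bounded : ∀ x → ∃[ B ] 0ℚ < B × ∃[ K ] (∀ n → K ℕ.≤ n → ∣ seq x n ∣ ≤ B)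
bounded x with cauchy x 1ℚ 0<1
... | K , h = 1ℚ + ∣ seq x K ∣ , 0<+≤ {1ℚ} {∣ seq x K ∣} 0<1 (0≤∣p∣ (seq x K)) , K , λ n K≤n →
  ≤-trans (∣a∣≤∣a-b∣+∣b∣ (seq x n) (seq x K)) (+-monoˡ-≤ ∣ seq x K ∣ (h n K K≤n ℕ.≤-refl))

_*ℝ_ : ℝ → ℝ → ℝ
x *ℝ y = mkℝ (λ n → seq x n * seq y n) go
  where
  go : ∀ ε → 0ℚ < ε → ∃[ K ] (∀ m n → K ℕ.≤ m → K ℕ.≤ n →
         ∣ seq x m * seq y m - seq x n * seq y n ∣ ≤ ε)
  go ε 0<ε =
    let (B , 0<B , K , hx) = bounded x
        (C , 0<C , L , hy) = bounded y
        0<η = 0<* {ε} {recip (B + C)} 0<ε (recip-pos (0<+ 0<B 0<C))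
        (K′ , cx) = cauchy x (ε * recip (B + C)) 0<η
        (L′ , cy) = cauchy y (ε * recip (B + C)) 0<η
    in (K ℕ.⊔ L) ℕ.⊔ (K′ ℕ.⊔ L′) , λ m n hm hn → ≤-trans
      (∣ab-cd∣≤ (seq x m) (seq x n) (seq y m) (seq y n)
        (hx m (⊔ˡ (⊔ˡ hm)))
        (cy m n (⊔ʳ {K′} (⊔ʳ {K ℕ.⊔ L} hm)) (⊔ʳ {K′} (⊔ʳ {K ℕ.⊔ L} hn)))
        (cx m n (⊔ˡ (⊔ʳ {K ℕ.⊔ L} hm)) (⊔ˡ (⊔ʳ {K ℕ.⊔ L} hn)))
        (hy n (⊔ʳ {K} (⊔ˡ hn))))
      (≤-reflexive (split-ε B C ε (0<+ 0<B 0<C)))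

-- The bound holds only eventually, so finitely many terms may be junk values of recip.
_⁻¹[_] : (x : ℝ) → 0ℝ <ℝ x → ℝ
x ⁻¹[ δ , 0<δ , L , hx ] = mkℝ (λ n → recip (seq x n)) go
  where
  go : ∀ ε → 0ℚ < ε → ∃[ K ] (∀ m n → K ℕ.≤ m → K ℕ.≤ n →
         ∣ recip (seq x m) - recip (seq x n) ∣ ≤ ε)
  go ε 0<ε =
    let (K , cx) = cauchy x (ε * (δ * δ)) (0<* {ε} {δ * δ} 0<ε (0<* 0<δ 0<δ))
        δ≤ : ∀ n → L ℕ.≤ n → δ ≤ seq x n
        δ≤ n h = subst (_≤ seq x n) (+-identityˡ δ) (hx n h)
        0<x : ∀ n → L ℕ.≤ n → 0ℚ < seq x n
        0<x n h = <-≤-trans 0<δ (δ≤ n h)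
        ∣u∣≤ : ∀ n → L ℕ.≤ n → ∣ recip (seq x n) ∣ ≤ recip δ
        ∣u∣≤ n h = subst (_≤ recip δ) (sym (0≤p⇒∣p∣≡p (recip-nonNeg (0<x n h))))
                         (recip-anti 0<δ (δ≤ n h))
    in L ℕ.⊔ K , λ m n hm hn → subst (λ z → ∣ z ∣ ≤ ε) (sym (recip-diff (0<x m (⊔ˡ hm)) (0<x n (⊔ˡ hn))))
      (≤-trans (∣*∣-≤ {seq x n - seq x m} {recip (seq x m) * recip (seq x n)}
                 (cx n m (⊔ʳ {L} hn) (⊔ʳ {L} hm))
                 (∣*∣-≤ {recip (seq x m)} {recip (seq x n)} (∣u∣≤ m (⊔ˡ hm)) (∣u∣≤ n (⊔ˡ hn))))
      (≤-reflexive (recip-ε δ ε 0<δ)))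

_/ℝ_[_] : (x y : ℝ) → 0ℝ <ℝ y → ℝ
x /ℝ y [ 0<y ] = x *ℝ (y ⁻¹[ 0<y ])

⌊√_⌋ : ℕ → ℕ
⌊√ zero ⌋  = 0
⌊√ suc n ⌋ with suc ⌊√ n ⌋ ℕ.* suc ⌊√ n ⌋ ℕ.≤? suc n
... | yes _ = suc ⌊√ n ⌋
... | no  _ = ⌊√ n ⌋

⌊√⌋-lower : ∀ n → ⌊√ n ⌋ ℕ.* ⌊√ n ⌋ ℕ.≤ n
⌊√⌋-lower zero    = ℕ.z≤n
⌊√⌋-lower (suc n) with suc ⌊√ n ⌋ ℕ.* suc ⌊√ n ⌋ ℕ.≤? suc n
... | yes h = h
... | no  _ = ℕ.m≤n⇒m≤1+n (⌊√⌋-lower n)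

⌊√⌋-upper : ∀ n → n ℕ.< suc ⌊√ n ⌋ ℕ.* suc ⌊√ n ⌋
⌊√⌋-upper zero    = ℕ.s≤s ℕ.z≤n
⌊√⌋-upper (suc n) with suc ⌊√ n ⌋ ℕ.* suc ⌊√ n ⌋ ℕ.≤? suc n
... | yes _ = ℕ.≤-trans (ℕ.s≤s (⌊√⌋-upper n))
                (ℕ.*-mono-< (ℕ.n<1+n (suc ⌊√ n ⌋)) (ℕ.n<1+n (suc ⌊√ n ⌋)))
... | no  h = ℕ.≰⇒> h

-- The n-th approximation to √ a is ⌊√ (a (n+1)²) ⌋ / (n+1).
√-num : ℕ → ℕ → ℕ
√-num a n = ⌊√ (a ℕ.* (suc n ℕ.* suc n)) ⌋

√-approx : ℕ → ℕ → ℚ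
√-approx a n = ι (√-num a n) * recip (ι (suc n))

private
  sq-cancel : ∀ {m n} → m ℕ.* m ℕ.< n ℕ.* n → m ℕ.≤ n
  sq-cancel {m} {n} h with m ℕ.≤? n
  ... | yes p = p
  ... | no  p = ⊥-elim (ℕ.<-irrefl refl (ℕ.<-trans h (ℕ.*-mono-< (ℕ.≰⇒> p) (ℕ.≰⇒> p))))

  sq-* : ∀ m n → (m ℕ.* n) ℕ.* (m ℕ.* n) ≡ (m ℕ.* m) ℕ.* (n ℕ.* n)
  sq-* m n = ℕ.[m*n]*[o*p]≡[m*o]*[n*p] m n m n

√-cross : ∀ a m n → √-num a m ℕ.* suc n ℕ.≤ suc (√-num a n) ℕ.* suc m
√-cross a m n = sq-cancel (subst₂ ℕ._<_ (sym (sq-* s (suc n))) (sym (sq-* (suc t) (suc m)))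
  (ℕ.≤-<-trans (ℕ.*-monoˡ-≤ (suc n ℕ.* suc n) (⌊√⌋-lower (a ℕ.* (suc m ℕ.* suc m))))
    (subst (ℕ._< (suc t ℕ.* suc t) ℕ.* M) eq
      (ℕ.*-monoˡ-< (suc m ℕ.* suc m) (⌊√⌋-upper (a ℕ.* (suc n ℕ.* suc n)))))))
  where
  s = √-num a m
  t = √-num a n
  M = suc m ℕ.* suc m
  N = suc n ℕ.* suc n
  eq : a ℕ.* N ℕ.* M ≡ a ℕ.* M ℕ.* N
  eq = trans (ℕ.*-assoc a N M) (trans (cong (a ℕ.*_) (ℕ.*-comm N M)) (sym (ℕ.*-assoc a M N)))

√-approx-≤ : ∀ a m n → √-approx a m ≤ √-approx a n + recip (ι (suc n))
√-approx-≤ a m n = subst₂ _≤_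
  (mod₁ (ι s * u) (*-recip (0<ι n))
    (solve 4 (λ s u q v → (s :* q) :* (u :* v) := s :* u :+ (s :* u) :* (q :* v :- con 1ℚ))
       refl (ι s) u (ι (suc n)) v))
  (mod₁ ((ι t + 1ℚ) * v) (*-recip (0<ι m))
    (solve 4 (λ t u p v → ((t :+ con 1ℚ) :* p) :* (u :* v)
        := (t :* v :+ v) :+ ((t :+ con 1ℚ) :* v) :* (p :* u :- con 1ℚ))
       refl (ι t) u (ι (suc m)) v))
  (*-monoʳ-≤-nonNeg (u * v)
    {{nonNegative (0≤* (recip-nonNeg (0<ι m)) (recip-nonNeg (0<ι n)))}}
    (subst₂ _≤_ (ι-* s (suc n))
      (trans (ι-* (suc t) (suc m)) (cong (_* ι (suc m)) (ι-suc t)))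
      (ι-mono (√-cross a m n))))
  where
  s = √-num a m
  t = √-num a n
  u = recip (ι (suc m))
  v = recip (ι (suc n))

√ℝ : ℕ → ℝ
√ℝ a = mkℝ (√-approx a) go
  where
  go : ∀ ε → 0ℚ < ε → ∃[ K ] (∀ m n → K ℕ.≤ m → K ℕ.≤ n →
         ∣ √-approx a m - √-approx a n ∣ ≤ ε)
  go ε 0<ε = K , λ m n K≤m K≤n → ∣∣-intro
      (≤-trans (√-approx-≤ a m n) (+-monoʳ-≤ (√-approx a n) (small n K≤n)))
      (≤-trans (√-approx-≤ a n m) (+-monoʳ-≤ (√-approx a m) (small m K≤m)))
    where
    K = proj₁ (archimedean-ε 1ℚ 0<ε)
    h = proj₂ (archimedean-ε 1ℚ 0<ε)
    small : ∀ n → K ℕ.≤ n → recip (ι (suc n)) ≤ ε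
    small n K≤n = *-cancelˡ-≤-pos (ι (suc n)) {{positive (0<ι n)}}
      (subst₂ _≤_ (sym (*-recip (0<ι n))) (*-comm ε (ι (suc n)))
        (≤-trans h (*-monoˡ-≤-nonNeg ε {{nonNegative (<⇒≤ 0<ε)}}
          (ι-mono (ℕ.m≤n⇒m≤1+n K≤n)))))

-- Left-endpoint Riemann sum of ∫ₐᵇ dt/t over 2ⁿ equal subintervals.
riemann : ℕ → ℚ → ℚ → ℚ
riemann zero    a b = (b - a) * recip a
riemann (suc n) a b = riemann n a (½ * (a + b)) + riemann n (½ * (a + b)) b

recip-* : ∀ {k a} → 0ℚ < k → 0ℚ < a → recip (k * a) ≡ recip k * recip a
recip-* {k} {a} 0<k 0<a = recip-unique {k * a} {recip k * recip a} (0<* 0<k 0<a)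
  (trans (solve 4 (λ k a u v → (k :* a) :* (u :* v) := (k :* u) :* (a :* v))
            refl k a (recip k) (recip a))
         (cong₂ _*_ (*-recip 0<k) (*-recip 0<a)))

riemann-scale : ∀ n {k a b} → 0ℚ < k → 0ℚ < a → 0ℚ < b →
                riemann n (k * a) (k * b) ≡ riemann n a b
riemann-scale zero {k} {a} {b} 0<k 0<a 0<b =
  trans (cong ((k * b - k * a) *_) (recip-* 0<k 0<a))
  (mod₁ {(k * b - k * a) * (recip k * recip a)} {(b - a) * recip a}
    ((b - a) * recip a) (*-recip 0<k)
    (solve 5 (λ k a b u v → (k :* b :- k :* a) :* (u :* v)
       := (b :- a) :* v :+ ((b :- a) :* v) :* (k :* u :- con 1ℚ))
       refl k a b (recip k) (recip a)))
riemann-scale (suc n) {k} {a} {b} 0<k 0<a 0<b =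
  trans (cong (λ m → riemann n (k * a) m + riemann n m (k * b)) mid)
        (cong₂ _+_ (riemann-scale n 0<k 0<a 0<m) (riemann-scale n 0<k 0<m 0<b))
  where
  0<m : 0ℚ < ½ * (a + b)
  0<m = 0<* 0<½ (0<+ 0<a 0<b)
  mid : ½ * (k * a + k * b) ≡ k * (½ * (a + b))
  mid = solve 3 (λ k a b → con ½ :* (k :* a :+ k :* b) := k :* (con ½ :* (a :+ b))) refl k a b

log-approx : ℕ → ℚ → ℚ
log-approx n r = riemann n 1ℚ r

-- One bisection of [1, r] gives log r = log s + log t with s = (1+r)/2 and t = r/s.
module Bisect {r : ℚ} (0<r : 0ℚ < r) where

  u v s t : ℚ
  u = recip r
  v = recip (1ℚ + r)
  s = ½ * (1ℚ + r)
  t = 2ℚ - 2ℚ * v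

  0<1+r : 0ℚ < 1ℚ + r
  0<1+r = 0<+ 0<1 0<r

  e₁ : r * u ≡ 1ℚ
  e₁ = *-recip 0<r

  e₂ : (1ℚ + r) * v ≡ 1ℚ
  e₂ = *-recip 0<1+r

  0≤u : 0ℚ ≤ u
  0≤u = recip-nonNeg 0<r

  0≤v : 0ℚ ≤ v
  0≤v = recip-nonNeg 0<1+r

  0<s : 0ℚ < s
  0<s = 0<* 0<½ 0<1+r

  0<t : 0ℚ < t
  0<t = subst (0ℚ <_) (sym (mod₁ (- 2ℚ) e₂
    (solve 2 (λ r v → con 2ℚ :- con 2ℚ :* v
       := con 2ℚ :* (r :* v) :+ con (- 2ℚ) :* ((con 1ℚ :+ r) :* v :- con 1ℚ)) refl r v)))
    (0<* 0<2 (0<* 0<r (recip-pos 0<1+r)))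

  st≡r : s * t ≡ r
  st≡r = mod₁ (- 1ℚ) e₂
    (solve 2 (λ r v → (con ½ :* (con 1ℚ :+ r)) :* (con 2ℚ :- con 2ℚ :* v)
       := r :+ con (- 1ℚ) :* ((con 1ℚ :+ r) :* v :- con 1ℚ)) refl r v)

  v[1+u] : v * (1ℚ + u) ≡ u
  v[1+u] = mod₂ (- v) u e₁ e₂
    (solve 3 (λ r u v → v :* (con 1ℚ :+ u)
       := u :+ (:- v) :* (r :* u :- con 1ℚ) :+ u :* ((con 1ℚ :+ r) :* v :- con 1ℚ)) refl r u v)

  v+vu : v + v * u ≡ u
  v+vu = trans (solve 2 (λ u v → v :+ v :* u := v :* (con 1ℚ :+ u)) refl u v) v[1+u]

  recip-s : recip s ≡ 2ℚ * v
  recip-s = recip-unique 0<s (trans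
    (solve 2 (λ r v → (con ½ :* (con 1ℚ :+ r)) :* (con 2ℚ :* v) := (con 1ℚ :+ r) :* v) refl r v)
    e₂)

  recip-t : recip t ≡ ½ * (1ℚ + u)
  recip-t = recip-unique 0<t (trans
    (solve 2 (λ u v → (con 2ℚ :- con 2ℚ :* v) :* (con ½ :* (con 1ℚ :+ u))
       := con 1ℚ :+ u :- v :* (con 1ℚ :+ u)) refl u v)
    (trans (cong (λ w → 1ℚ + u - w) v[1+u]) (solve 1 (λ u → con 1ℚ :+ u :- u := con 1ℚ) refl u)))

  bisect : ∀ n → log-approx (suc n) r ≡ log-approx n s + log-approx n t
  bisect n = cong (λ w → log-approx n s + w)
    (trans (cong₂ (riemann n) (sym (*-identityʳ s)) (sym st≡r)) (riemann-scale n 0<s 0<1 0<t))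

log-approx-0 : ∀ r → log-approx 0 r ≡ r - 1ℚ
log-approx-0 r = *-identityʳ (r - 1ℚ)

log-approx-upper : ∀ n {r} → 0ℚ < r → log-approx n r ≤ r - 1ℚ
log-approx-upper zero    {r} 0<r = ≤-reflexive (log-approx-0 r)
log-approx-upper (suc n) {r} 0<r = ≤-trans (≤-reflexive (bisect n))
  (≤-trans (+-mono-≤ (log-approx-upper n 0<s) (log-approx-upper n 0<t))
    (≤-diff (½ * ((r - 1ℚ) * (r - 1ℚ) * v))
      (0≤* (<⇒≤ 0<½) (0≤* (0≤sq (r - 1ℚ)) 0≤v))
      (mod₁ (-½ * (r - + 3 / 1)) e₂
        (solve 2 (λ r v → r :- con 1ℚ
           := (con ½ :* (con 1ℚ :+ r) :- con 1ℚ) :+ ((con 2ℚ :- con 2ℚ :* v) :- con 1ℚ)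
              :+ con ½ :* ((r :- con 1ℚ) :* (r :- con 1ℚ) :* v)
              :+ (con -½ :* (r :- con (+ 3 / 1))) :* ((con 1ℚ :+ r) :* v :- con 1ℚ))
           refl r v))))
  where open Bisect 0<r

log-approx-lower : ∀ n {r} → 0ℚ < r → 1ℚ - recip r ≤ log-approx n r
log-approx-lower zero {r} 0<r =
  ≤-diff ((r - 1ℚ) * (r - 1ℚ) * u) (0≤* (0≤sq (r - 1ℚ)) 0≤u)
    (trans (log-approx-0 r) (mod₁ (2ℚ - r) e₁
      (solve 2 (λ r u → r :- con 1ℚ := (con 1ℚ :- u) :+ (r :- con 1ℚ) :* (r :- con 1ℚ) :* u
          :+ (con 2ℚ :- r) :* (r :* u :- con 1ℚ)) refl r u)))
  where open Bisect 0<r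
log-approx-lower (suc n) {r} 0<r = ≤-trans
  (≤-trans (≤-diff (½ * ((r - 1ℚ) * (r - 1ℚ) * (u * v)))
      (0≤* (<⇒≤ 0<½) (0≤* (0≤sq (r - 1ℚ)) (0≤* 0≤u 0≤v)))
      (mod₂ (-½ * (1ℚ - + 4 / 1 * v)) (-½ * (u * (r + 1ℚ))) e₁ e₂
        (solve 3 (λ r u v → (con 1ℚ :- con 2ℚ :* v) :+ (con 1ℚ :- con ½ :* (con 1ℚ :+ u))
            := (con 1ℚ :- u) :+ con ½ :* ((r :- con 1ℚ) :* (r :- con 1ℚ) :* (u :* v))
               :+ (con -½ :* (con 1ℚ :- con (+ 4 / 1) :* v)) :* (r :* u :- con 1ℚ)
               :+ (con -½ :* (u :* (r :+ con 1ℚ))) :* ((con 1ℚ :+ r) :* v :- con 1ℚ))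
           refl r u v)))
    (≤-reflexive (cong₂ (λ a b → (1ℚ - a) + (1ℚ - b)) (sym recip-s) (sym recip-t))))
  (≤-trans (+-mono-≤ (log-approx-lower n 0<s) (log-approx-lower n 0<t))
    (≤-reflexive (sym (bisect n))))
  where open Bisect 0<r

-- The difference between the left- and right-endpoint sums over 2ⁿ subintervals of [1, r].
gap : ℕ → ℚ → ℚ
gap n r = ((r - 1ℚ) * (r - 1ℚ) * recip r) * half^ n

gap-bisect : ∀ n {r} (0<r : 0ℚ < r) → let open Bisect 0<r in
             gap n s + gap n t ≡ gap (suc n) r
gap-bisect n {r} 0<r =
  trans (cong₂ (λ a b → ((s - 1ℚ) * (s - 1ℚ) * a) * h + ((t - 1ℚ) * (t - 1ℚ) * b) * h)
           recip-s recip-t)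
  (trans (cong (λ w → ((s - 1ℚ) * (s - 1ℚ) * (2ℚ * v)) * h + (w * w * (½ * (1ℚ + u))) * h) t-1)
  (trans (solve 4 (λ r u v h →
      ((con ½ :* (con 1ℚ :+ r) :- con 1ℚ) :* (con ½ :* (con 1ℚ :+ r) :- con 1ℚ)
          :* (con 2ℚ :* v)) :* h
        :+ (((r :- con 1ℚ) :* v) :* ((r :- con 1ℚ) :* v) :* (con ½ :* (con 1ℚ :+ u))) :* h
      := ((r :- con 1ℚ) :* (r :- con 1ℚ) :* (v :+ v :* (v :* (con 1ℚ :+ u)))) :* (con ½ :* h))
      refl r u v h)
  (cong (λ w → ((r - 1ℚ) * (r - 1ℚ) * w) * (½ * h))
    (trans (cong (λ w → v + v * w) v[1+u]) v+vu))))
  where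
  open Bisect 0<r
  h = half^ n
  t-1 : t - 1ℚ ≡ (r - 1ℚ) * v
  t-1 = mod₁ (- 1ℚ) e₂
    (solve 2 (λ r v → (con 2ℚ :- con 2ℚ :* v) :- con 1ℚ := (r :- con 1ℚ) :* v
       :+ con (- 1ℚ) :* ((con 1ℚ :+ r) :* v :- con 1ℚ)) refl r v)

log-approx-anti : ∀ n j {r} → 0ℚ < r → log-approx (n ℕ.+ j) r ≤ log-approx n r
log-approx-anti zero j {r} 0<r =
  ≤-trans (log-approx-upper j 0<r) (≤-reflexive (sym (log-approx-0 r)))
log-approx-anti (suc n) j {r} 0<r = subst₂ _≤_ (sym (bisect (n ℕ.+ j))) (sym (bisect n))
  (+-mono-≤ (log-approx-anti n j 0<s) (log-approx-anti n j 0<t))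
  where open Bisect 0<r

log-approx-gap : ∀ n j {r} → 0ℚ < r → log-approx n r ≤ log-approx (n ℕ.+ j) r + gap n r
log-approx-gap zero j {r} 0<r = ≤-trans
  (≤-reflexive (trans (log-approx-0 r) (mod₁ (2ℚ - r) e₁
     (solve 2 (λ r u → r :- con 1ℚ
        := (con 1ℚ :- u) :+ ((r :- con 1ℚ) :* (r :- con 1ℚ) :* u) :* con 1ℚ
           :+ (con 2ℚ :- r) :* (r :* u :- con 1ℚ)) refl r u))))
  (+-monoˡ-≤ (gap 0 r) (log-approx-lower j 0<r))
  where open Bisect 0<r
log-approx-gap (suc n) j {r} 0<r = ≤-trans (≤-reflexive (bisect n))
  (≤-trans (+-mono-≤ (log-approx-gap n j 0<s) (log-approx-gap n j 0<t))
  (≤-reflexive (trans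
    (solve 4 (λ a b c d → (a :+ b) :+ (c :+ d) := (a :+ c) :+ (b :+ d)) refl
       (log-approx (n ℕ.+ j) s) (gap n s) (log-approx (n ℕ.+ j) t) (gap n t))
    (cong₂ _+_ (sym (bisect (n ℕ.+ j))) (gap-bisect n 0<r)))))
  where open Bisect 0<r

module Bisect₂ {r r′ : ℚ} (0<r : 0ℚ < r) (r≤r′ : r ≤ r′) where

  0<r′ : 0ℚ < r′
  0<r′ = <-≤-trans 0<r r≤r′

  open Bisect 0<r public
  open Bisect 0<r′ public using () renaming
    (s to s′; t to t′; v to v′; 0≤v to 0≤v′; 0<1+r to 0<1+r′; bisect to bisect′)

  v′≤v : v′ ≤ v
  v′≤v = recip-anti 0<1+r (+-monoʳ-≤ 1ℚ r≤r′)

  s≤s′ : s ≤ s′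
  s≤s′ = *-monoˡ-≤-nonNeg ½ (+-monoʳ-≤ 1ℚ r≤r′)

  t≤t′ : t ≤ t′
  t≤t′ = +-monoʳ-≤ 2ℚ (neg-antimono-≤ (*-monoˡ-≤-nonNeg 2ℚ v′≤v))

  s′-s : s′ - s ≡ ½ * (r′ - r)
  s′-s = solve 2 (λ r q → con ½ :* (con 1ℚ :+ q) :- con ½ :* (con 1ℚ :+ r) := con ½ :* (q :- r))
           refl r r′

  t′-t : t′ - t ≡ 2ℚ * ((r′ - r) * (v * v′))
  t′-t = trans
    (solve 2 (λ v w → (con 2ℚ :- con 2ℚ :* w) :- (con 2ℚ :- con 2ℚ :* v) := con 2ℚ :* (v :- w))
       refl v v′)
    (cong (2ℚ *_) (trans (recip-diff 0<1+r 0<1+r′)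
      (cong (_* (v * v′))
        (solve 2 (λ r q → (con 1ℚ :+ q) :- (con 1ℚ :+ r) := q :- r) refl r r′))))

log-approx-mono : ∀ n {r r′} → 0ℚ < r → r ≤ r′ → log-approx n r ≤ log-approx n r′
log-approx-mono zero {r} {r′} 0<r r≤r′ =
  subst₂ _≤_ (sym (log-approx-0 r)) (sym (log-approx-0 r′)) (+-monoˡ-≤ (- 1ℚ) r≤r′)
log-approx-mono (suc n) 0<r r≤r′ = subst₂ _≤_ (sym (bisect n)) (sym (bisect′ n))
  (+-mono-≤ (log-approx-mono n 0<s s≤s′) (log-approx-mono n 0<t t≤t′))
  where open Bisect₂ 0<r r≤r′

private
  regroup : ∀ a b c d → (a + b) + (c + d) ≡ (a + c) + (b + d)
  regroup = solve 4 (λ a b c d → (a :+ b) :+ (c :+ d) := (a :+ c) :+ (b :+ d)) refl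

  lip-0 : ∀ r r′ → r′ - 1ℚ ≡ (r - 1ℚ) + (r′ - r)
  lip-0 = solve 2 (λ r q → q :- con 1ℚ := (r :- con 1ℚ) :+ (q :- r)) refl

log-approx-lip-≤1 : ∀ n {r r′} → 0ℚ < r → r ≤ r′ → r ≤ 1ℚ →
                    log-approx n r′ ≤ log-approx n r + (r′ - r) * recip r
log-approx-lip-≤1 zero {r} {r′} 0<r r≤r′ r≤1 = ≤-trans
  (≤-reflexive (trans (log-approx-0 r′) (lip-0 r r′)))
  (+-mono-≤ (≤-reflexive (sym (log-approx-0 r)))
    (subst (_≤ (r′ - r) * recip r) (*-identityʳ (r′ - r))
      (*-monoˡ-≤-nonNeg (r′ - r) {{nonNegative (diff-≤ r≤r′)}} (recip-anti 0<r r≤1))))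
log-approx-lip-≤1 (suc n) {r} {r′} 0<r r≤r′ r≤1 = ≤-trans (≤-reflexive (bisect′ n))
  (≤-trans (+-mono-≤ (log-approx-lip-≤1 n 0<s s≤s′ s≤1) (log-approx-lip-≤1 n 0<t t≤t′ t≤1))
  (≤-trans (≤-reflexive (regroup (log-approx n s) ((s′ - s) * recip s)
                                 (log-approx n t) ((t′ - t) * recip t)))
  (+-mono-≤ (≤-reflexive (sym (bisect n))) step)))
  where
  open Bisect₂ 0<r r≤r′
  s≤1 : s ≤ 1ℚ
  s≤1 = *-monoˡ-≤-nonNeg ½ (+-monoʳ-≤ 1ℚ r≤1)
  t≤1 : t ≤ 1ℚ
  t≤1 = +-monoʳ-≤ 2ℚ (neg-antimono-≤ (*-monoˡ-≤-nonNeg 2ℚ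
          (recip-anti 0<1+r (+-monoʳ-≤ 1ℚ r≤1))))
  step : (s′ - s) * recip s + (t′ - t) * recip t ≤ (r′ - r) * u
  step = ≤-trans (≤-reflexive (trans
      (cong₂ _+_ (cong₂ _*_ s′-s recip-s) (cong₂ _*_ t′-t recip-t))
      (trans (solve 4 (λ d u v w → (con ½ :* d) :* (con 2ℚ :* v)
            :+ (con 2ℚ :* (d :* (v :* w))) :* (con ½ :* (con 1ℚ :+ u))
            := d :* (v :+ w :* (v :* (con 1ℚ :+ u)))) refl (r′ - r) u v v′)
        (cong (λ x → (r′ - r) * (v + v′ * x)) v[1+u]))))
    (*-monoˡ-≤-nonNeg (r′ - r) {{nonNegative (diff-≤ r≤r′)}}
      (≤-trans (+-monoʳ-≤ v (*-monoʳ-≤-nonNeg u {{nonNegative 0≤u}} v′≤v)) (≤-reflexive v+vu)))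

log-approx-lip-≥1 : ∀ n {r r′} → 0ℚ < r → r ≤ r′ → 1ℚ ≤ r →
                    log-approx n r′ ≤ log-approx n r + (r′ - r)
log-approx-lip-≥1 zero {r} {r′} 0<r r≤r′ 1≤r = ≤-reflexive
  (trans (log-approx-0 r′) (trans (lip-0 r r′)
    (cong (_+ (r′ - r)) (sym (log-approx-0 r)))))
log-approx-lip-≥1 (suc n) {r} {r′} 0<r r≤r′ 1≤r = ≤-trans (≤-reflexive (bisect′ n))
  (≤-trans (+-mono-≤ (log-approx-lip-≥1 n 0<s s≤s′ 1≤s) (log-approx-lip-≥1 n 0<t t≤t′ 1≤t))
  (≤-trans (≤-reflexive (regroup (log-approx n s) (s′ - s) (log-approx n t) (t′ - t)))
  (+-mono-≤ (≤-reflexive (sym (bisect n))) step)))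
  where
  open Bisect₂ 0<r r≤r′
  0<1+1 : 0ℚ < 1ℚ + 1ℚ
  0<1+1 = from-yes (0ℚ <? 1ℚ + 1ℚ)
  v≤½ : v ≤ ½
  v≤½ = recip-anti 0<1+1 (+-monoʳ-≤ 1ℚ 1≤r)
  1≤s : 1ℚ ≤ s
  1≤s = *-monoˡ-≤-nonNeg ½ (+-monoʳ-≤ 1ℚ 1≤r)
  1≤t : 1ℚ ≤ t
  1≤t = +-monoʳ-≤ 2ℚ (neg-antimono-≤ (*-monoˡ-≤-nonNeg 2ℚ v≤½))
  step : (s′ - s) + (t′ - t) ≤ r′ - r
  step = ≤-trans (≤-reflexive (trans (cong₂ _+_ s′-s t′-t)
      (solve 2 (λ d x → con ½ :* d :+ con 2ℚ :* (d :* x) := d :* (con ½ :+ con 2ℚ :* x))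
         refl (r′ - r) (v * v′))))
    (subst ((r′ - r) * (½ + 2ℚ * (v * v′)) ≤_) (*-identityʳ (r′ - r))
      (*-monoˡ-≤-nonNeg (r′ - r) {{nonNegative (diff-≤ r≤r′)}}
        (+-monoʳ-≤ ½ (*-monoˡ-≤-nonNeg 2ℚ (*-mono₂ 0≤v v≤½ 0≤v′ (≤-trans v′≤v v≤½))))))

log-approx-lip : ∀ n {r r′} → 0ℚ < r → r ≤ r′ →
                 log-approx n r′ ≤ log-approx n r + (r′ - r) * (1ℚ + recip r)
log-approx-lip n {r} {r′} 0<r r≤r′ with ≤-total r 1ℚ
... | inj₁ r≤1 = ≤-trans (log-approx-lip-≤1 n 0<r r≤r′ r≤1)
  (+-monoʳ-≤ (log-approx n r) (*-monoˡ-≤-nonNeg (r′ - r) {{nonNegative (diff-≤ r≤r′)}}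
    (≤-diff 1ℚ 0≤1 (+-comm 1ℚ (recip r)))))
... | inj₂ 1≤r = ≤-trans (log-approx-lip-≥1 n 0<r r≤r′ 1≤r)
  (+-monoʳ-≤ (log-approx n r) (subst (_≤ (r′ - r) * (1ℚ + recip r)) (*-identityʳ (r′ - r))
    (*-monoˡ-≤-nonNeg (r′ - r) {{nonNegative (diff-≤ r≤r′)}}
      (≤-diff (recip r) (recip-nonNeg 0<r) refl))))

log-approx-lip′ : ∀ n {δ p q e} → 0ℚ < δ → δ ≤ p → δ ≤ q → 0ℚ ≤ e → p ≤ q + e →
                  log-approx n p ≤ log-approx n q + e * (1ℚ + recip δ)
log-approx-lip′ n {δ} {p} {q} {e} 0<δ δ≤p δ≤q 0≤e h with ≤-total p q
... | inj₁ p≤q = ≤-trans (log-approx-mono n (<-≤-trans 0<δ δ≤p) p≤q)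
  (≤-diff (e * (1ℚ + recip δ)) (0≤* 0≤e (0≤+ 0≤1 (recip-nonNeg 0<δ))) refl)
... | inj₂ q≤p = ≤-trans (log-approx-lip n 0<q q≤p)
  (+-monoʳ-≤ (log-approx n q) (*-mono₂ (diff-≤ q≤p) (≤+⇒-≤ h)
    (0≤+ 0≤1 (recip-nonNeg 0<q)) (+-monoʳ-≤ 1ℚ (recip-anti 0<δ δ≤q))))
  where 0<q = <-≤-trans 0<δ δ≤q

gap-≤ : ∀ N {δ B r} → 0ℚ < δ → δ ≤ r → ∣ r ∣ ≤ B →
        gap N r ≤ ((B + 1ℚ) * (B + 1ℚ) * recip δ) * half^ N
gap-≤ N {δ} {B} {r} 0<δ δ≤r r≤B = *-monoʳ-≤-nonNeg (half^ N) {{nonNegative (0≤half^ N)}}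
  (*-mono₂ (0≤sq (r - 1ℚ)) sq≤ (recip-nonNeg (<-≤-trans 0<δ δ≤r)) (recip-anti 0<δ δ≤r))
  where
  ∣r-1∣≤ : ∣ r - 1ℚ ∣ ≤ B + 1ℚ
  ∣r-1∣≤ = ≤-trans (∣p-q∣≤∣p∣+∣q∣ r 1ℚ) (+-monoˡ-≤ 1ℚ r≤B)
  sq≤ : (r - 1ℚ) * (r - 1ℚ) ≤ (B + 1ℚ) * (B + 1ℚ)
  sq≤ = ≤-trans (≤∣∣ _) (∣*∣-≤ {r - 1ℚ} {r - 1ℚ} ∣r-1∣≤ ∣r-1∣≤)

gap-anti : ∀ N j {r} → 0ℚ < r → log-approx (N ℕ.+ j) r ≤ log-approx N r →
           ∀ k → log-approx (N ℕ.+ j) r ≤ log-approx (N ℕ.+ k) r + gap N r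
gap-anti N j 0<r h k = ≤-trans h (log-approx-gap N k 0<r)

-- log x = ∫₁ˣ dt/t, so log is the natural logarithm: the n-th approximation is the
-- 2ⁿ-piece sum up to the n-th approximation of x (signed, hence correct for x < 1 too).
log : (x : ℝ) → 0ℝ <ℝ x → ℝ
log x (δ , 0<δ , L , hx) = mkℝ (λ n → log-approx n (seq x n)) go
  where
  δ≤ : ∀ n → L ℕ.≤ n → δ ≤ seq x n
  δ≤ n h = subst (_≤ seq x n) (+-identityˡ δ) (hx n h)
  go : ∀ ε → 0ℚ < ε → ∃[ K ] (∀ m n → K ℕ.≤ m → K ℕ.≤ n →
         ∣ log-approx m (seq x m) - log-approx n (seq x n) ∣ ≤ ε)
  go ε 0<ε = M , λ m n hm hn → ∣∣-intro (half m n hm hn) (half n m hn hm)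
    where
    η = ½ * ε * recip (1ℚ + recip δ)
    0<1+δ′ : 0ℚ < 1ℚ + recip δ
    0<1+δ′ = 0<+ 0<1 (recip-pos 0<δ)
    0<½ε : 0ℚ < ½ * ε
    0<½ε = 0<* 0<½ 0<ε
    0<η : 0ℚ < η
    0<η = 0<* 0<½ε (recip-pos 0<1+δ′)
    0≤η = <⇒≤ 0<η
    B = proj₁ (bounded x)
    K = proj₁ (proj₂ (proj₂ (bounded x)))
    hB = proj₂ (proj₂ (proj₂ (bounded x)))
    K₁ = proj₁ (cauchy x η 0<η)
    cx = proj₂ (cauchy x η 0<η)
    arch = archimedean-ε ((B + 1ℚ) * (B + 1ℚ) * recip δ) 0<½ε
    N = proj₁ arch
    hN = proj₂ arch
    M = (L ℕ.⊔ K) ℕ.⊔ (K₁ ℕ.⊔ N)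
    gap≤ : ∀ {r} → δ ≤ r → ∣ r ∣ ≤ B → gap N r ≤ ½ * ε
    gap≤ h k = ≤-trans (gap-≤ N 0<δ h k)
      (≤-trans (*-monoʳ-≤-nonNeg (half^ N) {{nonNegative (0≤half^ N)}} hN)
      (subst₂ _≤_ (sym (*-assoc (½ * ε) (ι N) (half^ N))) (*-identityʳ (½ * ε))
        (*-monoˡ-≤-nonNeg (½ * ε) {{nonNegative (<⇒≤ 0<½ε)}} (ι*half^≤1 N))))
    half : ∀ m n → M ℕ.≤ m → M ℕ.≤ n →
           log-approx m (seq x m) ≤ log-approx n (seq x n) + ε
    half m n hm hn = ≤-trans
      (log-approx-lip′ m 0<δ (δ≤ m (⊔ˡ (⊔ˡ hm))) δn 0≤η
        (∣∣-elim (cx m n (⊔ˡ (⊔ʳ {L ℕ.⊔ K} hm)) (⊔ˡ (⊔ʳ {L ℕ.⊔ K} hn)))))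
      (≤-trans (+-mono-≤ change ≤-refl) (≤-reflexive
        (mod₁ (½ * ε) (*-recip 0<1+δ′)
          (solve 4 (λ f e a w → f :+ con ½ :* e :+ con ½ :* e :* w :* a
               := f :+ e :+ (con ½ :* e) :* (a :* w :- con 1ℚ))
             refl (log-approx n (seq x n)) ε (1ℚ + recip δ) (recip (1ℚ + recip δ))))))
      where
      N≤m = ⊔ʳ {K₁} (⊔ʳ {L ℕ.⊔ K} hm)
      N≤n = ⊔ʳ {K₁} (⊔ʳ {L ℕ.⊔ K} hn)
      δn = δ≤ n (⊔ˡ (⊔ˡ hn))
      0<xn = <-≤-trans 0<δ δn
      change : log-approx m (seq x n) ≤ log-approx n (seq x n) + ½ * ε
      change = ≤-trans
        (subst₂ (λ i j → log-approx i (seq x n) ≤ log-approx j (seq x n) + gap N (seq x n))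
          (ℕ.m+[n∸m]≡n N≤m) (ℕ.m+[n∸m]≡n N≤n)
          (gap-anti N (m ℕ.∸ N) 0<xn (log-approx-anti N (m ℕ.∸ N) 0<xn) (n ℕ.∸ N)))
        (+-monoʳ-≤ (log-approx n (seq x n)) (gap≤ δn (hB n (⊔ʳ {L} (⊔ˡ hn)))))

1<⇒0<log : ∀ x (0<x : 0ℝ <ℝ x) → 1ℝ <ℝ x → 0ℝ <ℝ log x 0<x
1<⇒0<log x 0<x (ε , 0<ε , K , h) =
  ε * w , 0<* 0<ε (recip-pos 0<1+ε) , K , λ n K≤n →
    ≤-trans (≤-reflexive (mod₁ 1ℚ (*-recip 0<1+ε)
       (solve 2 (λ e w → con 0ℚ :+ e :* w := (con 1ℚ :- w)
           :+ con 1ℚ :* ((con 1ℚ :+ e) :* w :- con 1ℚ)) refl ε w)))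
    (≤-trans (+-monoʳ-≤ 1ℚ (neg-antimono-≤ (recip-anti 0<1+ε (h n K≤n))))
      (log-approx-lower n (<-≤-trans 0<1+ε (h n K≤n))))
  where
  0<1+ε = 0<+ 0<1 0<ε
  w = recip (1ℚ + ε)

0<fromℕ : ∀ {n} → n ℕ.≥ 3 → 0ℝ <ℝ fromℕ n
0<fromℕ n≥3 = 1ℚ , 0<1 , 0 , λ _ _ → ι-mono {1} (ℕ.≤-trans (ℕ.s≤s ℕ.z≤n) n≥3)

logℕ : ∀ n → n ℕ.≥ 3 → ℝ
logℕ n n≥3 = log (fromℕ n) (0<fromℕ n≥3)

log-approx-≥ : ∀ {n m r} → 0ℚ < r → n ℕ.≤ m → log-approx n r - gap n r ≤ log-approx m r
log-approx-≥ {n} {m} {r} 0<r n≤m = ≤+⇒-≤ {log-approx n r} {gap n r} {log-approx m r}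
  (subst (log-approx n r ≤_) (+-comm (log-approx m r) (gap n r))
    (subst (λ i → log-approx n r ≤ log-approx i r + gap n r) (ℕ.m+[n∸m]≡n n≤m)
      (log-approx-gap n (m ℕ.∸ n) 0<r)))

1<log3 : ∀ m → 3 ℕ.≤ m → 1ℚ + + 1 / 100 ≤ log-approx m (ι 3)
1<log3 m 3≤m = ≤-trans {1ℚ + + 1 / 100} {log-approx 3 (ι 3) - gap 3 (ι 3)} {log-approx m (ι 3)}
  (from-yes (1ℚ + + 1 / 100 ≤? log-approx 3 (ι 3) - gap 3 (ι 3)))
  (log-approx-≥ {3} {m} {ι 3} (0<ι 2) 3≤m)

1<logℕ : ∀ n (n≥3 : n ℕ.≥ 3) → 1ℝ <ℝ logℕ n n≥3
1<logℕ n n≥3 = + 1 / 100 , from-yes (0ℚ <? + 1 / 100) , 3 , λ m 3≤m →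
  ≤-trans {1ℚ + + 1 / 100} {log-approx m (ι 3)} {log-approx m (ι n)}
    (1<log3 m 3≤m) (log-approx-mono m (0<ι 2) (ι-mono n≥3))

1<⇒0< : ∀ x → 1ℝ <ℝ x → 0ℝ <ℝ x
1<⇒0< x (ε , 0<ε , K , h) = ε , 0<ε , K , λ m K≤m → ≤-trans (+-monoˡ-≤ ε 0≤1) (h m K≤m)

0<logℕ : ∀ n (n≥3 : n ℕ.≥ 3) → 0ℝ <ℝ logℕ n n≥3
0<logℕ n n≥3 = 1<⇒0< (logℕ n n≥3) (1<logℕ n n≥3)

loglogℕ : ∀ n → n ℕ.≥ 3 → ℝ
loglogℕ n n≥3 = log (logℕ n n≥3) (0<logℕ n n≥3)

0<loglogℕ : ∀ n (n≥3 : n ℕ.≥ 3) → 0ℝ <ℝ loglogℕ n n≥3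
0<loglogℕ n n≥3 = 1<⇒0<log (logℕ n n≥3) (0<logℕ n n≥3) (1<logℕ n n≥3)

-- i : Fin N stands for the integer suc (toℕ i) ∈ {1,…,N}.
value : ∀ {N} → Fin N → ℕ
value i = suc (Fin.toℕ i)

Colouring : ℕ → ℕ → Set
Colouring N n = Fin N → Fin n

-- Of the equation x₁ + ⋯ + x_p = y₁ + ⋯ + y_q; the values of the variables may repeat.
record MonochromaticSolution (p q : ℕ) {N n : ℕ} (χ : Colouring N n) : Set where
  field
    colour   : Fin n
    xs       : Vec (Fin N) p
    ys       : Vec (Fin N) q
    xs-mono  : All (λ i → χ i ≡ colour) xs
    ys-mono  : All (λ i → χ i ≡ colour) ys
    equation : Vec.sum (Vec.map value xs) ≡ Vec.sum (Vec.map value ys)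

{-# OPTIONS --safe #-}
module Submission where

-- Put an arc of colour c from u to v whenever v - u is a positive integer of colour c. For a sign pattern σ
-- of length at most 3, the set W_σ(x) of ends of c-coloured walks from x with pattern σ spans no arc of
-- colour c: an arc between two such walks would give x₁ + ⋯ + x₄ = y₁ + y₂ + y₃ in colour c, hence (three
-- times) the equation with 12 and 9 terms.
--
-- Give a set S of vertices the potential Σ_{v ∈ S} (1 + r) ^ #{colours that v does not see in S}. Deleting
-- from S the c-neighbours of W_σ(x) multiplies the weight w(v) of each v ∈ W_σ(x) by at least 1 + r and
-- costs at most the weights of W_{+σ}(x) and W_{-σ}(x). If S is minimal with potential P > (1 + r) ^ n, then
-- no deletion increases P, so m(σ) = Σ_{x ∈ S} w(W_σ(x)) satisfies r m(σ) ≤ m(+σ) + m(-σ), whence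
-- r³ m(σ) ≤ 8 |S| P for |σ| = 1. Summing over colours and signs, r³ (|S| - 1) P ≤ 16 n |S| P, which is
-- impossible for r³ > 32 n and |S| ≥ 2. Hence N ≤ (1 + r) ^ n = O(n) ^ (n / 3), which is O(√((n - k)!)) even
-- for k = 1 + ⌊n / 8⌋.

open import Defs
open import Data.Nat
open import Data.Nat.Properties
open import Data.Nat.DivMod using (m≡m%n+[m/n]*n; m%n<n)
open import Data.Nat.Induction using (<-wellFounded)
open import Data.Nat.ListAction using (sum)
open import Data.Nat.Tactic.RingSolver using (solve-∀)
import Data.Integer as ℤ
open import Data.Rational using (ℚ; 0ℚ; 1ℚ)
import Data.Rational as ℚ
import Data.Rational.Properties as ℚ
open import Data.Rational.Solver using (module +-*-Solver)
open import Data.Bool using (Bool; true; false)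
open import Data.Fin using (Fin; toℕ; fromℕ<)
import Data.Fin.Properties as Fin
open import Data.List using (List; []; _∷_; map; length; filter; allFin)
open import Data.List.Properties using (filter-notAll; length-tabulate)
open import Data.List.Membership.Propositional using (_∈_; lose; find)
open import Data.List.Membership.Propositional.Properties using (∈-filter⁻; ∈-allFin)
open import Data.List.Relation.Unary.All as All using ()
open import Data.List.Relation.Unary.AllPairs using ([]; _∷_)
open import Data.List.Relation.Unary.Any as Any using (Any; here; there; any?)
open import Data.List.Relation.Unary.Unique.Propositional using (Unique)
import Data.List.Relation.Unary.Unique.Propositional.Properties as Unique
open import Data.Vec as Vec using (Vec)
import Data.Vec.Properties as Vec
open import Data.Vec.Relation.Unary.All as VecAll using ()
import Data.Vec.Relation.Unary.All.Properties as VecAll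
open import Data.Product using (_×_; _,_; proj₁; proj₂; ∃-syntax)
open import Data.Sum using (_⊎_; inj₁; inj₂)
open import Function using (_∘_; id)
open import Induction.WellFounded using (Acc; acc)
open import Relation.Binary.Definitions using (DecidableEquality; tri<; tri≈; tri>)
open import Relation.Binary.PropositionalEquality
open import Relation.Nullary using (¬_; Dec; yes; no; contradiction)
open import Relation.Nullary.Decidable using (¬?; _⊎-dec_; _×-dec_; from-yes)

-- Finite sums over lists and indicators of decidable propositions.

private variable
  A B : Set

∑ : List A → (A → ℕ) → ℕ
∑ xs f = sum (map f xs)

infix 6 ⟦_⟧

⟦_⟧ : Dec A → ℕ
⟦ yes _ ⟧ = 1
⟦ no  _ ⟧ = 0

⟦⟧≤1 : (a? : Dec A) → ⟦ a? ⟧ ≤ 1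
⟦⟧≤1 (yes _) = ≤-refl
⟦⟧≤1 (no  _) = z≤n

⟦⟧-mono : (A → B) → (a? : Dec A) (b? : Dec B) → ⟦ a? ⟧ ≤ ⟦ b? ⟧
⟦⟧-mono h (no _)  b?      = z≤n
⟦⟧-mono h (yes a) (yes _) = ≤-refl
⟦⟧-mono h (yes a) (no ¬b) = contradiction (h a) ¬b

⟦⟧-true : A → (a? : Dec A) → ⟦ a? ⟧ ≡ 1
⟦⟧-true a (yes _) = refl
⟦⟧-true a (no ¬a) = contradiction a ¬a

⟦⟧-false : ¬ A → (a? : Dec A) → ⟦ a? ⟧ ≡ 0
⟦⟧-false ¬a (yes a) = contradiction a ¬a
⟦⟧-false ¬a (no _)  = refl

∑-mono : ∀ xs {f g : A → ℕ} → (∀ {x} → x ∈ xs → f x ≤ g x) → ∑ xs f ≤ ∑ xs g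
∑-mono []       h = z≤n
∑-mono (x ∷ xs) h = +-mono-≤ (h (here refl)) (∑-mono xs (h ∘ there))

∑-cong : ∀ xs {f g : A → ℕ} → (∀ x → f x ≡ g x) → ∑ xs f ≡ ∑ xs g
∑-cong []       h = refl
∑-cong (x ∷ xs) h = cong₂ _+_ (h x) (∑-cong xs h)

∑-+ : ∀ xs (f g : A → ℕ) → ∑ xs (λ x → f x + g x) ≡ ∑ xs f + ∑ xs g
∑-+ []       f g = refl
∑-+ (x ∷ xs) f g = trans (cong (f x + g x +_) (∑-+ xs f g)) (interchange (f x) (g x) (∑ xs f) (∑ xs g))
  where
  interchange : ∀ a b c d → (a + b) + (c + d) ≡ (a + c) + (b + d)
  interchange = solve-∀

∑-* : ∀ k xs (f : A → ℕ) → ∑ xs (λ x → k * f x) ≡ k * ∑ xs f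
∑-* k []       f = sym (*-zeroʳ k)
∑-* k (x ∷ xs) f = trans (cong (k * f x +_) (∑-* k xs f)) (sym (*-distribˡ-+ k (f x) (∑ xs f)))

∑-const : ∀ (xs : List A) k → ∑ xs (λ _ → k) ≡ length xs * k
∑-const []       k = refl
∑-const (x ∷ xs) k = cong (k +_) (∑-const xs k)

∑-swap : ∀ xs ys (f : A → B → ℕ) →
         ∑ xs (λ x → ∑ ys (f x)) ≡ ∑ ys (λ y → ∑ xs (λ x → f x y))
∑-swap []       ys f = sym (trans (∑-const ys 0) (*-zeroʳ (length ys)))
∑-swap (x ∷ xs) ys f =
  trans (cong (∑ ys (f x) +_) (∑-swap xs ys f)) (sym (∑-+ ys (f x) (λ y → ∑ xs (λ x → f x y))))

∑-term : ∀ {xs x} (f : A → ℕ) → x ∈ xs → f x ≤ ∑ xs f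
∑-term f (here refl) = m≤m+n _ _
∑-term f (there p)   = ≤-trans (∑-term f p) (m≤n+m _ _)

∑-mono-< : ∀ xs {f g : A → ℕ} {x} → (∀ {x} → x ∈ xs → f x ≤ g x) → x ∈ xs → f x < g x →
           ∑ xs f < ∑ xs g
∑-mono-< (x ∷ xs) h (here refl) l = +-mono-<-≤ l (∑-mono xs (h ∘ there))
∑-mono-< (x ∷ xs) h (there p)   l = +-mono-≤-< (h (here refl)) (∑-mono-< xs (h ∘ there) p l)

∑-filter : ∀ {P : A → Set} (P? : ∀ x → Dec (P x)) xs (f : A → ℕ) →
           ∑ (filter P? xs) f ≡ ∑ xs (λ x → ⟦ P? x ⟧ * f x)
∑-filter P? []       f = refl
∑-filter P? (x ∷ xs) f with P? x
... | yes _ = cong₂ _+_ (sym (+-identityʳ (f x))) (∑-filter P? xs f)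
... | no  _ = ∑-filter P? xs f

∑-≡-unique : ∀ (_≟ᴬ_ : DecidableEquality A) {xs} y → Unique xs → ∑ xs (λ x → ⟦ x ≟ᴬ y ⟧) ≤ 1
∑-≡-unique _≟ᴬ_ y []           = z≤n
∑-≡-unique _≟ᴬ_ y (_∷_ {x} {xs} x∉ u) with x ≟ᴬ y
... | no  _    = ∑-≡-unique _≟ᴬ_ y u
... | yes refl = s≤s (≤-reflexive (n≤0⇒n≡0 (≤-trans
  (∑-mono xs (λ {z} z∈ → ≤-reflexive (⟦⟧-false (All.lookup x∉ z∈ ∘ sym) (z ≟ᴬ y))))
  (≤-reflexive (trans (∑-const xs 0) (*-zeroʳ (length xs)))))))

-- Signed one-coloured walks in an arc-coloured digraph.

module Walks {n : ℕ} {V : Set} (_≟ⱽ_ : DecidableEquality V)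
  (E : Fin n → V → V → Set) (E? : ∀ c u v → Dec (E c u v)) where

  Step : Bool → Fin n → V → V → Set
  Step true  c u v = E c u v
  Step false c u v = E c v u

  step? : ∀ s c u v → Dec (Step s c u v)
  step? true  c u v = E? c u v
  step? false c u v = E? c v u

  -- The head of the sign pattern is the last step.
  Walk : List V → Fin n → List Bool → V → V → Set
  Walk S c []      x v = x ≡ v
  Walk S c (s ∷ σ) x v = Any (λ u → Walk S c σ x u × Step s c u v) S

  walk? : ∀ S c σ x v → Dec (Walk S c σ x v)
  walk? S c []      x v = x ≟ⱽ v
  walk? S c (s ∷ σ) x v = any? (λ u → walk? S c σ x u ×-dec step? s c u v) S

  Sees : List V → Fin n → V → Set
  Sees S c v = Any (λ u → E c u v ⊎ E c v u) S

  sees? : ∀ S c v → Dec (Sees S c v)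
  sees? S c v = any? (λ u → E? c u v ⊎-dec E? c v u) S

  step⇒⊎ : ∀ s {c u v} → Step s c u v → E c u v ⊎ E c v u
  step⇒⊎ true  = inj₁
  step⇒⊎ false = inj₂

  walk⇒sees : ∀ {S c x v} σ → 1 ≤ length σ → Walk S c σ x v → Sees S c v
  walk⇒sees (s ∷ _) _ = Any.map (step⇒⊎ s ∘ proj₂)

  unseen : List V → V → ℕ
  unseen S v = ∑ (allFin n) (λ c → ⟦ ¬? (sees? S c v) ⟧)

  -- The potential of a vertex set and its change under deletion of a boundary.

  module Potential
    (independent : ∀ S c σ x u w → 1 ≤ length σ → length σ ≤ 3 →
                   Walk S c σ x u → Walk S c σ x w → ¬ E c u w)
    (complete : ∀ u v → u ≢ v → ∃[ c ] (E c u v ⊎ E c v u))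
    -- The 32 is 2 signs times 2 ^ 3 patterns per colour, and a factor 2 that absorbs the
    -- lower-order term `r ^ 3 * P` of `r³LP≤`.
    (r : ℕ) (32n<r³ : 32 * n < r ^ 3) where

    ρ : ℕ
    ρ = suc r

    weight : List V → V → ℕ
    weight S v = ρ ^ unseen S v

    potential : List V → ℕ
    potential S = ∑ S (weight S)

    1≤weight : ∀ S v → 1 ≤ weight S v
    1≤weight S v = m^n>0 ρ (unseen S v)

    unseen≤n : ∀ S v → unseen S v ≤ n
    unseen≤n S v = ≤-trans (∑-mono (allFin n) (λ {c} _ → ⟦⟧≤1 (¬? (sees? S c v))))
      (≤-reflexive (trans (∑-const (allFin n) 1) (trans (*-identityʳ _) (length-tabulate id))))

    weight≤ρⁿ : ∀ S v → weight S v ≤ ρ ^ n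
    weight≤ρⁿ S v = ^-monoʳ-≤ ρ (unseen≤n S v)

    module Move (S : List V) (c : Fin n) (σ : List Bool) (x : V)
      (1≤σ : 1 ≤ length σ) (σ≤3 : length σ ≤ 3) where

      Reached Boundary : V → Set
      Reached    = Walk S c σ x
      Boundary v = Walk S c (true ∷ σ) x v ⊎ Walk S c (false ∷ σ) x v

      reached? : ∀ v → Dec (Reached v)
      reached? = walk? S c σ x

      boundary? : ∀ v → Dec (Boundary v)
      boundary? v = walk? S c (true ∷ σ) x v ⊎-dec walk? S c (false ∷ σ) x v

      S′ : List V
      S′ = filter (¬? ∘ boundary?) S

      S′⊆S : ∀ {v} → v ∈ S′ → v ∈ S
      S′⊆S = proj₁ ∘ ∈-filter⁻ (¬? ∘ boundary?)

      -- The last step of the longer walk is an arc between `v` and another end of a `σ`-walk from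
      -- `x`; `independent` excludes it in either direction.
      reached⇒¬boundary : ∀ {v} → Reached v → ¬ Boundary v
      reached⇒¬boundary v! (inj₁ w) with u , _ , u! , e ← find w =
        independent S c σ x _ _ 1≤σ σ≤3 u! v! e
      reached⇒¬boundary v! (inj₂ w) with u , _ , u! , e ← find w =
        independent S c σ x _ _ 1≤σ σ≤3 v! u! e

      -- The arc prolongs the walk from `v` to `u`, so an arc from `u` to `v` is traversed
      -- backwards.
      neighbour⇒boundary : ∀ {u v} → v ∈ S → Reached v → E c u v ⊎ E c v u → Boundary u
      neighbour⇒boundary v∈S v! (inj₁ e) = inj₂ (lose v∈S (v! , e))
      neighbour⇒boundary v∈S v! (inj₂ e) = inj₁ (lose v∈S (v! , e))

      reached⇒sees : ∀ {v} → Reached v → Sees S c v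
      reached⇒sees = walk⇒sees σ 1≤σ

      reached⇒¬sees′ : ∀ {v} → v ∈ S → Reached v → ¬ Sees S′ c v
      reached⇒¬sees′ v∈S v! w with u , u∈S′ , e ← find w =
        proj₂ (∈-filter⁻ (¬? ∘ boundary?) {xs = S} u∈S′) (neighbour⇒boundary v∈S v! e)

      unseen-mono : ∀ v d → ⟦ ¬? (sees? S d v) ⟧ ≤ ⟦ ¬? (sees? S′ d v) ⟧
      unseen-mono v d = ⟦⟧-mono
        (λ ¬s s′ → ¬s (let u , u∈ , e = find s′ in lose (S′⊆S u∈) e)) _ _

      weight-mono : ∀ v → weight S v ≤ weight S′ v
      weight-mono v = ^-monoʳ-≤ ρ (∑-mono (allFin n) (λ {d} _ → unseen-mono v d))

      -- The last step of the walk to `v` shows that `v` sees `c` in `S`, while all its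
      -- `c`-neighbours are deleted. No other colour becomes seen by a deletion, so the exponent
      -- grows by at least one.
      weight-gain : ∀ {v} → v ∈ S → Reached v → ρ * weight S v ≤ weight S′ v
      weight-gain {v} v∈S v! = ^-monoʳ-≤ ρ {suc (unseen S v)} (∑-mono-< (allFin n)
        (λ {d} _ → unseen-mono v d) (∈-allFin c)
        (subst₂ _<_ (sym (⟦⟧-false (λ ¬s → ¬s (reached⇒sees v!)) (¬? (sees? S c v))))
                    (sym (⟦⟧-true (reached⇒¬sees′ v∈S v!) (¬? (sees? S′ c v)))) ≤-refl))

      gain loss : V → ℕ
      gain v = weight S v * ⟦ reached? v ⟧
      loss v = weight S v * (⟦ walk? S c (true ∷ σ) x v ⟧ + ⟦ walk? S c (false ∷ σ) x v ⟧)

      -- A reached vertex survives and gains the factor 1 + r. Any other vertex either survives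
      -- without losing weight or lies in the boundary, where `loss` pays for it.
      balance : ∀ {v} → v ∈ S →
        weight S v + r * gain v ≤ ⟦ ¬? (boundary? v) ⟧ * weight S′ v + loss v
      balance {v} v∈S with reached? v
      ... | yes v! rewrite ⟦⟧-true (reached⇒¬boundary v!) (¬? (boundary? v)) =
        ≤-trans (≤-reflexive (cong (λ k → weight S v + r * k) (*-identityʳ (weight S v))))
          (≤-trans (weight-gain v∈S v!)
            (≤-trans (≤-reflexive (sym (+-identityʳ _))) (m≤m+n _ (loss v))))
      ... | no _ = ≤-trans (≤-reflexive (trans (cong (λ k → weight S v + r * k) (*-zeroʳ (weight S v)))
                     (trans (cong (weight S v +_) (*-zeroʳ r)) (+-identityʳ _)))) lower
        where
        lower : weight S v ≤ ⟦ ¬? (boundary? v) ⟧ * weight S′ v + loss v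
        lower with walk? S c (true ∷ σ) x v | walk? S c (false ∷ σ) x v
        ... | yes _ | q     = ≤-trans (m≤m*n (weight S v) (suc ⟦ q ⟧)) (m≤n+m _ _)
        ... | no  _ | yes _ = ≤-trans (m≤m*n (weight S v) 1) (m≤n+m _ _)
        ... | no  _ | no  _ = ≤-trans (weight-mono v) (≤-trans (m≤m+n _ 0) (m≤m+n _ _))

      total : potential S + r * ∑ S gain ≤ potential S′ + ∑ S loss
      total = begin
        potential S + r * ∑ S gain
          ≡⟨ cong (potential S +_) (∑-* r S gain) ⟨
        potential S + ∑ S (λ v → r * gain v)
          ≡⟨ ∑-+ S (weight S) _ ⟨
        ∑ S (λ v → weight S v + r * gain v)
          ≤⟨ ∑-mono S balance ⟩
        ∑ S (λ v → ⟦ ¬? (boundary? v) ⟧ * weight S′ v + loss v)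
          ≡⟨ ∑-+ S _ loss ⟩
        ∑ S (λ v → ⟦ ¬? (boundary? v) ⟧ * weight S′ v) + ∑ S loss
          ≡⟨ cong (_+ ∑ S loss) (∑-filter (¬? ∘ boundary?) S (weight S′)) ⟨
        potential S′ + ∑ S loss ∎
        where open ≤-Reasoning

      -- The pattern is nonempty, so a reached vertex has a `c`-neighbour in `S`, and this neighbour
      -- is deleted.
      shrinks : Any Reached S → length S′ < length S
      shrinks r! =
        let v , v∈S , v! = find r!
            u , u∈S , e  = find (reached⇒sees v!)
        in filter-notAll (¬? ∘ boundary?) S
             (lose u∈S (λ ¬b → ¬b (neighbour⇒boundary v∈S v! e)))

      gain≤loss : (length S′ < length S → potential S′ ≤ potential S) →
                  r * ∑ S gain ≤ ∑ S loss
      gain≤loss h with any? reached? S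
      ... | yes r! = +-cancelˡ-≤ (potential S) _ _
                       (≤-trans total (+-monoˡ-≤ (∑ S loss) (h (shrinks r!))))
      ... | no ¬r! = ≤-trans (≤-reflexive (trans (cong (r *_) ∑gain≡0) (*-zeroʳ r))) z≤n
        where
        ∑gain≡0 : ∑ S gain ≡ 0
        ∑gain≡0 = n≤0⇒n≡0 (≤-trans
          (∑-mono S (λ {v} v∈S → ≤-reflexive
            (trans (cong (weight S v *_) (⟦⟧-false (¬r! ∘ lose v∈S) (reached? v)))
                   (*-zeroʳ (weight S v)))))
          (≤-reflexive (trans (∑-const S 0) (*-zeroʳ (length S)))))

    -- Counting walks in a set whose potential no shorter list exceeds.

    module Maximal (S : List V) (S! : Unique S)
      (maximal : ∀ T → Unique T → length T < length S → potential T ≤ potential S) where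

      open ≤-Reasoning

      L P : ℕ
      L = length S
      P = potential S

      mass : Fin n → List Bool → ℕ
      mass c σ = ∑ S (λ x → ∑ S (λ v → weight S v * ⟦ walk? S c σ x v ⟧))

      mass-upper : ∀ c σ → mass c σ ≤ L * P
      mass-upper c σ = ≤-trans
        (∑-mono S (λ {x} _ → ∑-mono S (λ {v} _ →
          ≤-trans (*-monoʳ-≤ (weight S v) (⟦⟧≤1 (walk? S c σ x v))) (≤-reflexive (*-identityʳ _)))))
        (≤-reflexive (∑-const S P))

      mass-step : ∀ c σ → 1 ≤ length σ → length σ ≤ 3 →
                  r * mass c σ ≤ mass c (true ∷ σ) + mass c (false ∷ σ)
      mass-step c σ 1≤σ σ≤3 = begin
        r * mass c σ                            ≡⟨ ∑-* r S _ ⟨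
        ∑ S (λ x → r * ∑ S (Move.gain S c σ x 1≤σ σ≤3))
          ≤⟨ ∑-mono S (λ {x} _ → let open Move S c σ x 1≤σ σ≤3 in gain≤loss (maximal S′ (Unique.filter⁺ (¬? ∘ boundary?) S!))) ⟩
        ∑ S (λ x → ∑ S (Move.loss S c σ x 1≤σ σ≤3))
          ≡⟨ ∑-cong S (λ x → trans (∑-cong S (λ v → *-distribˡ-+ (weight S v) _ _)) (∑-+ S _ _)) ⟩
        ∑ S (λ x → ∑ S (λ v → weight S v * ⟦ walk? S c (true ∷ σ) x v ⟧)
                 + ∑ S (λ v → weight S v * ⟦ walk? S c (false ∷ σ) x v ⟧))
          ≡⟨ ∑-+ S _ _ ⟩
        mass c (true ∷ σ) + mass c (false ∷ σ)  ∎

      -- Each use of `mass-step` trades a factor `r` for two patterns that are longer by one; the 2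
      -- ^ j final patterns are bounded trivially. Since `mass-step` needs length at most 3, the
      -- final length may be 4.
      mass-growth : ∀ c j σ → 1 ≤ length σ → length σ + j ≤ 4 → r ^ j * mass c σ ≤ 2 ^ j * (L * P)
      mass-growth c zero    σ 1≤σ σ≤4 = *-monoʳ-≤ 1 (mass-upper c σ)
      mass-growth c (suc j) σ 1≤σ σ≤4 = begin
        r ^ suc j * mass c σ       ≡⟨ assoc r (r ^ j) (mass c σ) ⟩
        r ^ j * (r * mass c σ)     ≤⟨ *-monoʳ-≤ (r ^ j) (mass-step c σ 1≤σ (≤-trans (m≤m+n _ j) σ+j≤3)) ⟩
        r ^ j * (mass c (true ∷ σ) + mass c (false ∷ σ))             ≡⟨ *-distribˡ-+ (r ^ j) _ _ ⟩
        r ^ j * mass c (true ∷ σ) + r ^ j * mass c (false ∷ σ)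
          ≤⟨ +-mono-≤ (mass-growth c j (true ∷ σ) (s≤s z≤n) (s≤s σ+j≤3))
                      (mass-growth c j (false ∷ σ) (s≤s z≤n) (s≤s σ+j≤3)) ⟩
        2 ^ j * (L * P) + 2 ^ j * (L * P)                            ≡⟨ double (2 ^ j) (L * P) ⟩
        2 ^ suc j * (L * P)        ∎
        where
        σ+j≤3 : length σ + j ≤ 3
        σ+j≤3 = s≤s⁻¹ (subst (_≤ 4) (+-suc (length σ) j) σ≤4)
        assoc : ∀ a b c → a * b * c ≡ b * (a * c)
        assoc = solve-∀
        double : ∀ a b → a * b + a * b ≡ 2 * a * b
        double = solve-∀

      arcs : V → V → ℕ
      arcs x v = ∑ (allFin n) (λ c → ⟦ walk? S c (true ∷ []) x v ⟧ + ⟦ walk? S c (false ∷ []) x v ⟧)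

      adjacent : ∀ {x} v → x ∈ S → 1 ≤ ⟦ x ≟ⱽ v ⟧ + arcs x v
      adjacent {x} v x∈S with x ≟ⱽ v
      ... | yes _  = s≤s z≤n
      ... | no x≢v with complete x v x≢v
      ... | c , inj₁ e = ≤-trans
        (≤-trans (≤-reflexive (sym (⟦⟧-true (lose x∈S (refl , e)) (walk? S c (true ∷ []) x v)))) (m≤m+n _ _))
        (∑-term _ (∈-allFin c))
      ... | c , inj₂ e = ≤-trans
        (≤-trans (≤-reflexive (sym (⟦⟧-true (lose x∈S (refl , e)) (walk? S c (false ∷ []) x v)))) (m≤n+m _ _))
        (∑-term _ (∈-allFin c))

      -- Every element of `S` other than `v` is joined to `v` in some colour, and `v` occurs at most
      -- once in `S`.
      degree : ∀ v → L ≤ 1 + ∑ S (λ x → arcs x v)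
      degree v = begin
        L                                               ≡⟨ trans (∑-const S 1) (*-identityʳ L) ⟨
        ∑ S (λ _ → 1)                                   ≤⟨ ∑-mono S (adjacent v) ⟩
        ∑ S (λ x → ⟦ x ≟ⱽ v ⟧ + arcs x v)               ≡⟨ ∑-+ S _ _ ⟩
        ∑ S (λ x → ⟦ x ≟ⱽ v ⟧) + ∑ S (λ x → arcs x v)   ≤⟨ +-monoˡ-≤ _ (∑-≡-unique _≟ⱽ_ v S!) ⟩
        1 + ∑ S (λ x → arcs x v)                        ∎

      -- Double counting of weighted single steps: by end vertex on the left, by colour and sign on
      -- the right.
      arcs-mass : ∑ S (λ v → weight S v * ∑ S (λ x → arcs x v)) ≡
                  ∑ (allFin n) (λ c → mass c (true ∷ []) + mass c (false ∷ []))
      arcs-mass = begin-equality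
        ∑ S (λ v → weight S v * ∑ S (λ x → arcs x v))
          ≡⟨ ∑-cong S (λ v → sym (∑-* (weight S v) S _)) ⟩
        ∑ S (λ v → ∑ S (λ x → weight S v * arcs x v))
          ≡⟨ ∑-swap S S _ ⟩
        ∑ S (λ x → ∑ S (λ v → weight S v * arcs x v))
          ≡⟨ ∑-cong S (λ x → trans
               (∑-cong S (λ v → trans (sym (∑-* (weight S v) (allFin n) _))
                 (∑-cong (allFin n) (λ c → *-distribˡ-+ (weight S v) _ _))))
               (∑-swap S (allFin n) _)) ⟩
        ∑ S (λ x → ∑ (allFin n) (λ c → ∑ S (λ v → w c true x v + w c false x v)))
          ≡⟨ ∑-swap S (allFin n) _ ⟩
        ∑ (allFin n) (λ c → ∑ S (λ x → ∑ S (λ v → w c true x v + w c false x v)))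
          ≡⟨ ∑-cong (allFin n) (λ c → trans (∑-cong S (λ x → ∑-+ S _ _)) (∑-+ S _ _)) ⟩
        ∑ (allFin n) (λ c → mass c (true ∷ []) + mass c (false ∷ [])) ∎
        where
        w : Fin n → Bool → V → V → ℕ
        w c s x v = weight S v * ⟦ walk? S c (s ∷ []) x v ⟧

      mass-lower : L * P ≤ P + ∑ (allFin n) (λ c → mass c (true ∷ []) + mass c (false ∷ []))
      mass-lower = begin
        L * P                               ≡⟨ ∑-* L S (weight S) ⟨
        ∑ S (λ v → L * weight S v)
          ≤⟨ ∑-mono S (λ {v} _ → ≤-trans (*-monoˡ-≤ (weight S v) (degree v))
               (≤-reflexive (cong (weight S v +_) (*-comm _ (weight S v))))) ⟩
        ∑ S (λ v → weight S v + weight S v * ∑ S (λ x → arcs x v))   ≡⟨ ∑-+ S _ _ ⟩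
        P + ∑ S (λ v → weight S v * ∑ S (λ x → arcs x v))            ≡⟨ cong (P +_) arcs-mass ⟩
        P + ∑ (allFin n) (λ c → mass c (true ∷ []) + mass c (false ∷ [])) ∎

      r³LP≤ : r ^ 3 * (L * P) ≤ r ^ 3 * P + n * (16 * (L * P))
      r³LP≤ = begin
        r ^ 3 * (L * P)                     ≤⟨ *-monoʳ-≤ (r ^ 3) mass-lower ⟩
        r ^ 3 * (P + ∑ (allFin n) m)        ≡⟨ *-distribˡ-+ (r ^ 3) P _ ⟩
        r ^ 3 * P + r ^ 3 * ∑ (allFin n) m  ≡⟨ cong (r ^ 3 * P +_) (∑-* (r ^ 3) (allFin n) m) ⟨
        r ^ 3 * P + ∑ (allFin n) (λ c → r ^ 3 * m c)
          ≤⟨ +-monoʳ-≤ (r ^ 3 * P) (∑-mono (allFin n) (λ {c} _ → bound c)) ⟩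
        r ^ 3 * P + ∑ (allFin n) (λ _ → 16 * (L * P))
          ≡⟨ cong (r ^ 3 * P +_) (trans (∑-const (allFin n) _) (cong (_* (16 * (L * P))) (length-tabulate {n = n} id))) ⟩
        r ^ 3 * P + n * (16 * (L * P))      ∎
        where
        m : Fin n → ℕ
        m c = mass c (true ∷ []) + mass c (false ∷ [])
        bound : ∀ c → r ^ 3 * m c ≤ 16 * (L * P)
        bound c = begin
          r ^ 3 * m c                                                    ≡⟨ *-distribˡ-+ (r ^ 3) _ _ ⟩
          r ^ 3 * mass c (true ∷ []) + r ^ 3 * mass c (false ∷ [])
            ≤⟨ +-mono-≤ (mass-growth c 3 (true ∷ []) ≤-refl ≤-refl) (mass-growth c 3 (false ∷ []) ≤-refl ≤-refl) ⟩
          8 * (L * P) + 8 * (L * P)                                      ≡⟨ *-distribʳ-+ (L * P) 8 8 ⟨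
          16 * (L * P)                                                   ∎

      -- If `L` were at least 2, then 2P would be at most LP. Doubling `r³LP≤` and cancelling r³LP
      -- would leave r³LP ≤ 32nLP, against `32n<r³`.
      length≤1 : L ≤ 1
      length≤1 with L ≤? 1
      ... | yes h = h
      ... | no ¬h = contradiction (+-cancelˡ-≤ (R * X) _ _ doubled) (<⇒≱ (*-monoˡ-< X {{>-nonZero 0<X}} 32n<r³))
        where
        R X : ℕ
        R = r ^ 3
        X = L * P
        2≤L : 2 ≤ L
        2≤L = ≰⇒> ¬h
        L≤P : L ≤ P
        L≤P = ≤-trans (≤-reflexive (sym (trans (∑-const S 1) (*-identityʳ L))))
                      (∑-mono S (λ {v} _ → 1≤weight S v))
        0<X : 0 < X
        0<X = *-mono-≤ (≤-trans (s≤s z≤n) 2≤L) (≤-trans (≤-trans (s≤s z≤n) 2≤L) L≤P)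
        regroup : ∀ R P n X → 2 * (R * P + n * (16 * X)) ≡ R * (2 * P) + 32 * n * X
        regroup = solve-∀
        twice : ∀ a → a + a ≡ 2 * a
        twice = solve-∀
        doubled : R * X + R * X ≤ R * X + 32 * n * X
        doubled = begin
          R * X + R * X                 ≡⟨ twice (R * X) ⟩
          2 * (R * X)                   ≤⟨ *-monoʳ-≤ 2 r³LP≤ ⟩
          2 * (R * P + n * (16 * X))    ≡⟨ regroup R P n X ⟩
          R * (2 * P) + 32 * n * X      ≤⟨ +-monoˡ-≤ _ (*-monoʳ-≤ R (*-monoˡ-≤ P 2≤L)) ⟩
          R * X + 32 * n * X            ∎

    -- Strong induction on the length. If the bound failed for `S`, the induction hypothesis would
    -- make `S` satisfy the assumption of `Maximal`, so `S` would have at most one element; but then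
    -- the bound holds.
    potential≤ρⁿ : ∀ S → Unique S → Acc _<_ (length S) → potential S ≤ ρ ^ n
    potential≤ρⁿ S S! (acc rec) with potential S ≤? ρ ^ n
    ... | yes h = h
    ... | no ¬h = small S (Maximal.length≤1 S S! (λ T T! T<S →
      ≤-trans (potential≤ρⁿ T T! (rec T<S)) (<⇒≤ (≰⇒> ¬h))))
      where
      small : ∀ S → length S ≤ 1 → potential S ≤ ρ ^ n
      small []          _ = z≤n
      small (v ∷ [])    _ = ≤-trans (≤-reflexive (+-identityʳ _)) (weight≤ρⁿ (v ∷ []) v)
      small (_ ∷ _ ∷ _) (s≤s ())

    length≤ρⁿ : ∀ S → Unique S → length S ≤ ρ ^ n
    length≤ρⁿ S S! = ≤-trans
      (≤-trans (≤-reflexive (sym (trans (∑-const S 1) (*-identityʳ _))))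
               (∑-mono S (λ {v} _ → 1≤weight S v)))
      (potential≤ρⁿ S S! (<-wellFounded (length S)))

-- Arcs from coloured differences, and the equations that walks produce.

positives : List Bool → ℕ
positives []          = 0
positives (true ∷ σ)  = suc (positives σ)
positives (false ∷ σ) = positives σ

negatives : List Bool → ℕ
negatives []          = 0
negatives (true ∷ σ)  = negatives σ
negatives (false ∷ σ) = suc (negatives σ)

positives+negatives : ∀ σ → positives σ + negatives σ ≡ length σ
positives+negatives []          = refl
positives+negatives (true ∷ σ)  = cong suc (positives+negatives σ)
positives+negatives (false ∷ σ) = trans (+-suc _ _) (cong suc (positives+negatives σ))

module Differences {N n : ℕ} (χ : Colouring N n) where

  -- One side of an equation together with its number of terms, so that sides can be joined,
  -- repeated and padded to the required lengths.
  SumOf : Fin n → ℕ → ℕ → Set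
  SumOf c p t = ∃[ xs ] VecAll.All (λ i → χ i ≡ c) {p} xs × Vec.sum (Vec.map value xs) ≡ t

  sum-0 : ∀ {c} → SumOf c 0 0
  sum-0 = Vec.[] , VecAll.[] , refl

  sum-1 : ∀ {c} i → χ i ≡ c → SumOf c 1 (value i)
  sum-1 i χi = i Vec.∷ Vec.[] , χi VecAll.∷ VecAll.[] , +-identityʳ (value i)

  sum-+ : ∀ {c p q s t} → SumOf c p s → SumOf c q t → SumOf c (p + q) (s + t)
  sum-+ (xs , as , refl) (ys , bs , refl) = xs Vec.++ ys , VecAll.++⁺ as bs ,
    trans (cong Vec.sum (Vec.map-++ value xs ys)) (Vec.sum-++ (Vec.map value xs))

  sum-* : ∀ {c p t} k → SumOf c p t → SumOf c (k * p) (k * t)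
  sum-* zero    _ = sum-0
  sum-* (suc k) s = sum-+ s (sum-* k s)

  recount : ∀ {c p q t} → p ≡ q → SumOf c p t → SumOf c q t
  recount refl s = s

  -- The vertices are the numbers 0 to N - 1, so every positive difference lies in the coloured
  -- range.
  Arc : Fin n → Fin N → Fin N → Set
  Arc c u v = ∃[ i ] χ i ≡ c × toℕ u + value i ≡ toℕ v

  arc? : ∀ c u v → Dec (Arc c u v)
  arc? c u v = Fin.any? (λ i → (χ i Fin.≟ c) ×-dec (toℕ u + value i ≟ toℕ v))

  open Walks Fin._≟_ Arc arc?

  <⇒arc : ∀ {u v : Fin N} → toℕ u < toℕ v → ∃[ c ] Arc c u v
  <⇒arc {u} {v} u<v = χ i , i , refl ,
    trans (cong (λ k → toℕ u + suc k) (Fin.toℕ-fromℕ< d<N))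
      (trans (+-suc (toℕ u) _) (m+[n∸m]≡n u<v))
    where
    -- The index is the difference minus one, because `value` adds one.
    d<N : toℕ v ∸ suc (toℕ u) < N
    d<N = ≤-<-trans (m∸n≤m (toℕ v) (suc (toℕ u))) (Fin.toℕ<n v)
    i = fromℕ< d<N

  arc-complete : ∀ u v → u ≢ v → ∃[ c ] (Arc c u v ⊎ Arc c v u)
  arc-complete u v u≢v with <-cmp (toℕ u) (toℕ v)
  ... | tri< u<v _ _ = let c , e = <⇒arc u<v in c , inj₁ e
  ... | tri≈ _ u≡v _ = contradiction (Fin.toℕ-injective u≡v) u≢v
  ... | tri> _ _ v<u = let c , e = <⇒arc v<u in c , inj₂ e

  -- The displacement of a walk telescopes to its forward steps minus its backward steps; it is
  -- stated without subtraction.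
  walk-sums : ∀ {S c x v} σ → Walk S c σ x v →
    ∃[ s ] ∃[ t ] SumOf c (positives σ) s × SumOf c (negatives σ) t × toℕ x + s ≡ toℕ v + t
  walk-sums []          refl = 0 , 0 , sum-0 , sum-0 , refl
  walk-sums {x = x} {v} (true ∷ σ) w =
    let u , _ , w′ , i , χi , e = find w
        s , t , p , q , h = walk-sums σ w′
    in value i + s , t , sum-+ (sum-1 i χi) p , q , forward (toℕ x) (toℕ u) (value i) (toℕ v) s t h e
    where
    shuffle : ∀ u a t → u + t + a ≡ u + a + t
    shuffle = solve-∀
    forward : ∀ x u a v s t → x + s ≡ u + t → u + a ≡ v → x + (a + s) ≡ v + t
    forward x u a _ s t h refl =
      trans (cong (x +_) (+-comm a s)) (trans (sym (+-assoc x s a)) (trans (cong (_+ a) h) (shuffle u a t)))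
  walk-sums {x = x} {v} (false ∷ σ) w =
    let u , _ , w′ , i , χi , e = find w
        s , t , p , q , h = walk-sums σ w′
    in s , value i + t , p , sum-+ (sum-1 i χi) q , trans h (trans (cong (_+ t) (sym e)) (+-assoc (toℕ v) (value i) t))

  module SolutionFree (free : ¬ MonochromaticSolution 12 9 χ) where

    -- A monochromatic solution of x₁ + ⋯ + x₄ = y₁ + y₂ + y₃ taken three times solves the equation.
    no-4-3 : ∀ {c t} → SumOf c 4 t → ¬ SumOf c 3 t
    no-4-3 {c} p q with xs , as , e ← sum-* 3 p | ys , bs , f ← sum-* 3 q = free record
      { colour = c ; xs = xs ; ys = ys ; xs-mono = as ; ys-mono = bs ; equation = trans e (sym f) }

    -- Adding 3 - j copies of the same number `value i` to both sides gives 4 and 3 terms.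
    no-suc-j : ∀ {c t} j → j ≤ 3 → ∀ i → χ i ≡ c → SumOf c (suc j) t → ¬ SumOf c j t
    no-suc-j {c} {t} j j≤3 i χi p q = no-4-3
      (recount (cong suc (m+[n∸m]≡n j≤3)) (pad p))
      (recount (m+[n∸m]≡n j≤3) (pad q))
      where
      pad : ∀ {m} → SumOf c m t → SumOf c (m + (3 ∸ j)) (t + (3 ∸ j) * value i)
      pad s = sum-+ s (recount (*-identityʳ (3 ∸ j)) (sum-* (3 ∸ j) (sum-1 i χi)))

    -- Subtracting the two displacements from `x` expresses the arc by the steps. With the negative
    -- terms moved across, value i + s + t′ = s′ + t has one term more on the left than the
    -- `length σ` terms on the right.
    arc-independent : ∀ S c σ x u w → 1 ≤ length σ → length σ ≤ 3 →
      Walk S c σ x u → Walk S c σ x w → ¬ Arc c u w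
    arc-independent S c σ x u w _ σ≤3 v₁ v₂ (i , χi , e) =
      let s , t , p , q , h = walk-sums σ v₁
          s′ , t′ , p′ , q′ , h′ = walk-sums σ v₂
          P = sum-+ (sum-1 i χi) (sum-+ p q′)
          Q = sum-+ p′ q
      in no-suc-j (length σ) σ≤3 i χi
           (recount (cong suc (positives+negatives σ)) P)
           (subst (SumOf c (length σ))
             (sym (close (toℕ x) (toℕ u) (value i) (toℕ w) s t s′ t′ e h h′))
             (recount (positives+negatives σ) Q))
      where
      shuffle₁ : ∀ x u a s t → x + u + (a + (s + t)) ≡ (u + a + t) + (x + s)
      shuffle₁ = solve-∀
      shuffle₂ : ∀ x u s t → (x + s) + (u + t) ≡ x + u + (s + t)
      shuffle₂ = solve-∀
      close : ∀ x u a w s t s′ t′ → u + a ≡ w → x + s ≡ u + t → x + s′ ≡ w + t′ →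
              a + (s + t′) ≡ s′ + t
      close x u a _ s t s′ t′ refl h h′ = +-cancelˡ-≡ (x + u) _ _
        (trans (shuffle₁ x u a s t′) (trans (cong₂ _+_ (sym h′) h) (shuffle₂ x u s′ t)))

    N≤[1+r]ⁿ : ∀ r → 32 * n < r ^ 3 → N ≤ suc r ^ n
    N≤[1+r]ⁿ r h = subst (_≤ suc r ^ n) (length-tabulate {n = N} id)
      (Potential.length≤ρⁿ arc-independent arc-complete r h (allFin N) (Unique.allFin⁺ N))

-- Estimates for powers and factorials.

cube-root : ∀ m → ∃[ r ] r ^ 3 ≤ m × m < suc r ^ 3
cube-root zero    = 0 , z≤n , s≤s z≤n
cube-root (suc m) with r , lo , hi ← cube-root m | suc m <? suc r ^ 3
... | yes h = r , m≤n⇒m≤1+n lo , h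
... | no ¬h = suc r , ≮⇒≥ ¬h , ≤-<-trans hi (^-monoˡ-< 3 (n<1+n (suc r)))

^-swap : ∀ m a b → (m ^ a) ^ b ≡ (m ^ b) ^ a
^-swap m a b = trans (^-*-assoc m a b) (trans (cong (m ^_) (*-comm a b)) (sym (^-*-assoc m b a)))

^-distribʳ-* : ∀ e a b → (a * b) ^ e ≡ a ^ e * b ^ e
^-distribʳ-* zero    a b = refl
^-distribʳ-* (suc e) a b = trans (cong (a * b *_) (^-distribʳ-* e a b)) ([m*n]*[o*p]≡[m*o]*[n*p] a b (a ^ e) (b ^ e))

^*!≤! : ∀ n j → n ^ j * n ! ≤ (n + j) !
^*!≤! n zero    = ≤-reflexive (trans (*-identityˡ _) (cong _! (sym (+-identityʳ n))))
^*!≤! n (suc j) = begin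
  n * n ^ j * n !             ≡⟨ *-assoc n (n ^ j) (n !) ⟩
  n * (n ^ j * n !)           ≤⟨ *-mono-≤ (m≤n⇒m≤1+n (m≤m+n n j)) (^*!≤! n j) ⟩
  suc (n + j) * (n + j) !     ≡⟨ cong _! (+-suc n j) ⟨
  (n + suc j) !               ∎
  where open ≤-Reasoning

-- The central binomial coefficient at most quadruples at each step: (2n + 2)(2n + 1) ≤ 4(n + 1)².
[n+n]!≤4ⁿ*n!*n! : ∀ n → (n + n) ! ≤ 4 ^ n * (n ! * n !)
[n+n]!≤4ⁿ*n!*n! zero    = ≤-refl
[n+n]!≤4ⁿ*n!*n! (suc n) = begin
  (suc n + suc n) !                                 ≡⟨ cong (λ k → suc k !) (+-suc n n) ⟩
  suc (suc (n + n)) * (suc (n + n) * (n + n) !)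
    ≤⟨ *-monoʳ-≤ (2 + (n + n)) (*-mono-≤ (n≤1+n (suc (n + n))) ([n+n]!≤4ⁿ*n!*n! n)) ⟩
  (2 + (n + n)) * ((2 + (n + n)) * (4 ^ n * (n ! * n !)))       ≡⟨ regroup n (4 ^ n) (n !) ⟩
  4 ^ suc n * (suc n ! * suc n !)                   ∎
  where
  open ≤-Reasoning
  regroup : ∀ n a b → (2 + (n + n)) * ((2 + (n + n)) * (a * (b * b))) ≡
            4 * a * ((1 + n) * b * ((1 + n) * b))
  regroup = solve-∀

-- A weak form of Stirling's formula: (2n)! is compared from both sides and n! is cancelled.
nⁿ≤4ⁿ*n! : ∀ n → n ^ n ≤ 4 ^ n * n !
nⁿ≤4ⁿ*n! n = *-cancelʳ-≤ (n ^ n) (4 ^ n * n !) (n !) {{>-nonZero (n!>0 n)}} (begin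
  n ^ n * n !              ≤⟨ ^*!≤! n n ⟩
  (n + n) !                ≤⟨ [n+n]!≤4ⁿ*n!*n! n ⟩
  4 ^ n * (n ! * n !)      ≡⟨ *-assoc (4 ^ n) (n !) (n !) ⟨
  4 ^ n * n ! * n !        ∎)
  where
  open ≤-Reasoning
  n!>0 : ∀ n → 0 < n !
  n!>0 zero    = s≤s z≤n
  n!>0 (suc n) = *-mono-≤ {1} {suc n} (s≤s z≤n) (n!>0 n)

-- Spare factors `j` absorb an exponential in `s`: either g ≤ j, or s ≤ j < g and the constant alone
-- suffices.
^≤const*^ : ∀ g {s j} → 1 ≤ g → 1 ≤ j → s ≤ j → g ^ s ≤ g ^ g * j ^ s
^≤const*^ g {s} {j} 1≤g 1≤j s≤j with g ≤? j
... | yes g≤j = ≤-trans (^-monoˡ-≤ s g≤j) (m≤n*m (j ^ s) (g ^ g) {{m^n≢0 g g {{>-nonZero 1≤g}}}})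
... | no  g≰j = ≤-trans (^-monoʳ-≤ g {{>-nonZero 1≤g}} (≤-trans s≤j (<⇒≤ (≰⇒> g≰j))))
                        (m≤m*n (g ^ g) (j ^ s) {{m^n≢0 j s {{>-nonZero 1≤j}}}})

-- The choice k = 1 + ⌊n / 8⌋ is large enough for the lower bound on `k` and small enough to leave
-- `s` = n - 3k the spare factors that `power≤factorial` needs.
split-n : ∀ n → 3 ≤ n → ∃[ k ] ∃[ s ] n ≡ s + 3 * k × n ≤ 8 * k × 2 * k ≤ s + 5 × 1 ≤ k
split-n n 3≤n = 1 + n / 8 , proj₁ rest , proj₁ (proj₂ rest) , n≤8k , proj₂ (proj₂ rest) , s≤s z≤n
  where
  t = n % 8
  n≤8k : n ≤ 8 * (1 + n / 8)
  n≤8k = begin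
    n                  ≡⟨ m≡m%n+[m/n]*n n 8 ⟩
    t + n / 8 * 8      ≤⟨ +-monoˡ-≤ (n / 8 * 8) (<⇒≤ (m%n<n n 8)) ⟩
    8 + n / 8 * 8      ≡⟨ *-comm (1 + n / 8) 8 ⟩
    8 * (1 + n / 8)    ∎
    where open ≤-Reasoning
  rest : ∃[ s ] n ≡ s + 3 * (1 + n / 8) × 2 * (1 + n / 8) ≤ s + 5
  rest with n / 8 | m≡m%n+[m/n]*n n 8
  ... | zero  | n≡ = n ∸ 3 , sym (m∸n+n≡m 3≤n) , ≤-trans (m≤n+m 2 3) (m≤n+m 5 (n ∸ 3))
  ... | suc q | n≡ = 2 + 5 * q + t , trans n≡ (regroup t q) ,
    ≤-trans (m≤m+n _ (3 + 3 * q + t)) (≤-reflexive (slack t q))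
    where
    regroup : ∀ t q → t + (1 + q) * 8 ≡ 2 + 5 * q + t + 3 * (2 + q)
    regroup = solve-∀
    slack : ∀ t q → 2 * (2 + q) + (3 + 3 * q + t) ≡ 2 + 5 * q + t + 5
    slack = solve-∀

abstract
  -- With n = s + 3k and j = n - k: since j ^ 3j ≤ 64 ^ j * (j !) ^ 3 and 3j = 2n + s, there are s ≥ (j - 5) / 2
  -- factors j to spare. The block is abstract because C is far too large to be evaluated.
  power≤factorial : ∀ a → 1 ≤ a → ∃[ C ] ∀ s k → 1 ≤ k → 2 * k ≤ s + 5 →
    ((s + 3 * k) * a) ^ (2 * (s + 3 * k)) ≤ C * ((s + 2 * k) !) ^ 3
  power≤factorial a 1≤a = C , bound
    where
    -- From n ≤ 2j come na ≤ bj and b ^ 2n ≤ b ^ 4j; `h` joins b ^ 4 with the 64 = 4 ^ 3 of the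
    -- cubed factorial estimate. As j ≤ 5 + 2s, h ^ j ≤ h ^ 5 * g ^ s, and `^≤const*^` turns g ^ s
    -- into g ^ g * j ^ s.
    b h g C : ℕ
    b = 2 * a
    h = b ^ 4 * 64
    g = h ^ 2
    C = h ^ 5 * g ^ g
    1≤b : 1 ≤ b
    1≤b = *-mono-≤ {1} {2} (s≤s z≤n) 1≤a
    1≤h : 1 ≤ h
    1≤h = *-mono-≤ {1} {b ^ 4} (m^n>0 b {{>-nonZero 1≤b}} 4) (s≤s z≤n)
    1≤g : 1 ≤ g
    1≤g = m^n>0 h {{>-nonZero 1≤h}} 2
    bound : ∀ s k → 1 ≤ k → 2 * k ≤ s + 5 →
      ((s + 3 * k) * a) ^ (2 * (s + 3 * k)) ≤ C * ((s + 2 * k) !) ^ 3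
    bound s k 1≤k 2k≤s+5 = *-cancelʳ-≤ _ _ (j ^ s) {{m^n≢0 j s {{>-nonZero 1≤j}}}} (begin
      (n * a) ^ (2 * n) * j ^ s
        ≤⟨ *-monoˡ-≤ (j ^ s) (^-monoˡ-≤ (2 * n) na≤bj) ⟩
      (b * j) ^ (2 * n) * j ^ s
        ≡⟨ cong (_* j ^ s) (^-distribʳ-* (2 * n) b j) ⟩
      b ^ (2 * n) * j ^ (2 * n) * j ^ s
        ≡⟨ trans (*-assoc (b ^ (2 * n)) _ _) (cong (b ^ (2 * n) *_) (sym (^-distribˡ-+-* j (2 * n) s))) ⟩
      b ^ (2 * n) * j ^ (2 * n + s)
        ≤⟨ *-mono-≤ (^-monoʳ-≤ b {{>-nonZero 1≤b}} 2n≤4j)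
                    (≤-reflexive (trans (cong (j ^_) (2n+s≡j*3 s k)) (sym (^-*-assoc j j 3)))) ⟩
      b ^ (4 * j) * (j ^ j) ^ 3
        ≤⟨ *-monoʳ-≤ (b ^ (4 * j)) (^-monoˡ-≤ 3 (nⁿ≤4ⁿ*n! j)) ⟩
      b ^ (4 * j) * (4 ^ j * j !) ^ 3
        ≡⟨ cong₂ _*_ (sym (^-*-assoc b 4 j)) (trans (^-distribʳ-* 3 (4 ^ j) (j !)) (cong (_* (j !) ^ 3) (^-swap 4 j 3))) ⟩
      (b ^ 4) ^ j * (64 ^ j * (j !) ^ 3)
        ≡⟨ trans (sym (*-assoc ((b ^ 4) ^ j) (64 ^ j) _)) (cong (_* (j !) ^ 3) (sym (^-distribʳ-* j (b ^ 4) 64))) ⟩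
      h ^ j * (j !) ^ 3
        ≤⟨ *-monoˡ-≤ ((j !) ^ 3) hʲ≤ ⟩
      C * j ^ s * (j !) ^ 3
        ≡⟨ trans (*-assoc C _ _) (trans (cong (C *_) (*-comm (j ^ s) _)) (sym (*-assoc C _ _))) ⟩
      C * (j !) ^ 3 * j ^ s ∎)
      where
      open ≤-Reasoning
      n j : ℕ
      n = s + 3 * k
      j = s + 2 * k
      1≤j : 1 ≤ j
      1≤j = ≤-trans 1≤k (≤-trans (m≤m+n k _) (m≤n+m (2 * k) s))
      n+≡2j : ∀ s k → s + 3 * k + (s + k) ≡ 2 * (s + 2 * k)
      n+≡2j = solve-∀
      n≤2j : n ≤ 2 * j
      n≤2j = ≤-trans (m≤m+n n (s + k)) (≤-reflexive (n+≡2j s k))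
      na≤bj : n * a ≤ b * j
      na≤bj = ≤-trans (*-monoˡ-≤ a n≤2j) (≤-reflexive (flip j a))
        where
        flip : ∀ j a → 2 * j * a ≡ 2 * a * j
        flip = solve-∀
      2n≤4j : 2 * n ≤ 4 * j
      2n≤4j = ≤-trans (*-monoʳ-≤ 2 n≤2j) (≤-reflexive (sym (*-assoc 2 2 j)))
      2n+s≡j*3 : ∀ s k → 2 * (s + 3 * k) + s ≡ (s + 2 * k) * 3
      2n+s≡j*3 = solve-∀
      j≤5+2s : j ≤ 5 + 2 * s
      j≤5+2s = ≤-trans (+-monoʳ-≤ s 2k≤s+5) (≤-reflexive (tidy s))
        where
        tidy : ∀ s → s + (s + 5) ≡ 5 + 2 * s
        tidy = solve-∀
      hʲ≤ : h ^ j ≤ C * j ^ s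
      hʲ≤ = begin
        h ^ j                      ≤⟨ ^-monoʳ-≤ h {{>-nonZero 1≤h}} j≤5+2s ⟩
        h ^ (5 + 2 * s)            ≡⟨ ^-distribˡ-+-* h 5 (2 * s) ⟩
        h ^ 5 * h ^ (2 * s)        ≡⟨ cong (h ^ 5 *_) (sym (^-*-assoc h 2 s)) ⟩
        h ^ 5 * g ^ s              ≤⟨ *-monoʳ-≤ (h ^ 5) (^≤const*^ g 1≤g 1≤j (m≤m+n s (2 * k))) ⟩
        h ^ 5 * (g ^ g * j ^ s)    ≡⟨ *-assoc (h ^ 5) (g ^ g) (j ^ s) ⟨
        C * j ^ s                  ∎

-- The bound on N in integer form.

module _ {N n : ℕ} (χ : Colouring N n) (free : ¬ MonochromaticSolution 12 9 χ) where

  -- The parameter of `N≤[1+r]ⁿ` is one more than the integer cube root `suc r` of 32n. The base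
  -- `3 + r` is at most three times that root, so its cube is at most 27 * 32 * n. The sixth power
  -- avoids both cube and square roots.
  N⁶≤[864n]²ⁿ : 1 ≤ n → N ^ 6 ≤ (n * 864) ^ (2 * n)
  N⁶≤[864n]²ⁿ 1≤n with cube-root (32 * n)
  ... | zero  , _  , hi = contradiction (≤-trans 1≤n (m≤n*m n 32)) (<⇒≱ hi)
  ... | suc r , lo , hi = begin
    N ^ 6                    ≤⟨ ^-monoˡ-≤ 6 (Differences.SolutionFree.N≤[1+r]ⁿ χ free (2 + r) hi) ⟩
    ((3 + r) ^ n) ^ 6        ≡⟨ trans (^-swap (3 + r) n 6) (sym (six (3 + r))) ⟩
    ((3 + r) ^ 3) ^ (2 * n)  ≤⟨ ^-monoˡ-≤ (2 * n) cube ⟩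
    (n * 864) ^ (2 * n)      ∎
    where
    open ≤-Reasoning
    six : ∀ q → (q ^ 3) ^ (2 * n) ≡ (q ^ 6) ^ n
    six q = trans (sym (^-*-assoc (q ^ 3) 2 n)) (cong (_^ n) (^-*-assoc q 3 2))
    cube : (3 + r) ^ 3 ≤ n * 864
    cube = begin
      (3 + r) ^ 3            ≤⟨ ^-monoˡ-≤ 3 (≤-trans (m≤m+n (3 + r) (2 * r)) (≤-reflexive (triple r))) ⟩
      (3 * suc r) ^ 3        ≡⟨ ^-distribʳ-* 3 3 (suc r) ⟩
      27 * suc r ^ 3         ≤⟨ *-monoʳ-≤ 27 lo ⟩
      27 * (32 * n)          ≡⟨ trans (sym (*-assoc 27 32 n)) (*-comm 864 n) ⟩
      n * 864                ∎
      where
      triple : ∀ r → 3 + r + 2 * r ≡ 3 * (1 + r)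
      triple = solve-∀

cube-cancel-≤ : ∀ {m n} → m ^ 3 ≤ n ^ 3 → m ≤ n
cube-cancel-≤ {m} {n} h with m ≤? n
... | yes p = p
... | no ¬p = contradiction h (<⇒≱ (^-monoˡ-< 3 (≰⇒> ¬p)))

square-bound : ∃[ C ] 1 ≤ C × ∀ n → 3 ≤ n → ∃[ k ] n ≤ 8 * k × k ≤ n ×
  (∀ N (χ : Colouring N n) → ¬ MonochromaticSolution 12 9 χ → N * N ≤ C * C * (n ∸ k) !)
-- The successor makes the constant positive, and C ≤ suc C ^ 3 allows cube roots to be taken.
square-bound = suc C , s≤s z≤n , bound
  where
  C = proj₁ (power≤factorial 864 (s≤s z≤n))
  bound : ∀ n → 3 ≤ n → ∃[ k ] n ≤ 8 * k × k ≤ n ×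
    (∀ N (χ : Colouring N n) → ¬ MonochromaticSolution 12 9 χ → N * N ≤ suc C * suc C * (n ∸ k) !)
  bound n 3≤n with split-n n 3≤n
  ... | k , s , refl , n≤8k , 2k≤s+5 , 1≤k = k , n≤8k , ≤-trans (m≤n*m k 3) (m≤n+m _ s) , λ N χ free →
    ≤-trans (cube-cancel-≤ (begin
      (N * N) ^ 3                      ≡⟨ cong (_^ 3) (cong (N *_) (sym (*-identityʳ N))) ⟩
      (N ^ 2) ^ 3                      ≡⟨ ^-*-assoc N 2 3 ⟩
      N ^ 6                            ≤⟨ N⁶≤[864n]²ⁿ χ free (≤-trans (s≤s z≤n) 3≤n) ⟩
      (n * 864) ^ (2 * n)              ≤⟨ proj₂ (power≤factorial 864 (s≤s z≤n)) s k 1≤k 2k≤s+5 ⟩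
      C * (j !) ^ 3                    ≤⟨ *-monoˡ-≤ ((j !) ^ 3) (≤-trans (n≤1+n C) (m≤m*n (suc C) (suc C ^ 2) {{m^n≢0 (suc C) 2}})) ⟩
      suc C ^ 3 * (j !) ^ 3            ≡⟨ ^-distribʳ-* 3 (suc C) (j !) ⟨
      (suc C * j !) ^ 3                ∎))
    (≤-trans (*-monoˡ-≤ (j !) (m≤m*n (suc C) (suc C)))
      (≤-reflexive (cong (λ i → suc C * suc C * i !) (sym n∸k≡j))))
    where
    open ≤-Reasoning
    j = s + 2 * k
    n∸k≡j : s + 3 * k ∸ k ≡ j
    n∸k≡j = trans (cong (_∸ k) (regroup s k)) (m+n∸n≡m j k)
      where
      regroup : ∀ s k → s + 3 * k ≡ s + 2 * k + k
      regroup = solve-∀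

-- Passage to real square roots and logarithms.

square-cancel-≤ : ∀ {m n} → m * m ≤ n * n → m ≤ n
square-cancel-≤ {m} {n} h with m ≤? n
... | yes p = p
... | no ¬p = contradiction h (<⇒≱ (*-mono-< (≰⇒> ¬p) (≰⇒> ¬p)))

√-num-bound : ∀ {N C a} i → N * N ≤ C * C * a → N * suc i ≤ C * suc (√-num a i)
√-num-bound {N} {C} {a} i h = square-cancel-≤ (begin
  (N * suc i) * (N * suc i)        ≡⟨ [m*n]*[o*p]≡[m*o]*[n*p] N (suc i) N (suc i) ⟩
  N * N * M                        ≤⟨ *-monoˡ-≤ M h ⟩
  C * C * a * M                    ≡⟨ *-assoc (C * C) a M ⟩
  C * C * (a * M)                  ≤⟨ *-monoʳ-≤ (C * C) (<⇒≤ (⌊√⌋-upper (a * M))) ⟩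
  C * C * (suc t * suc t)          ≡⟨ [m*n]*[o*p]≡[m*o]*[n*p] C C (suc t) (suc t) ⟩
  (C * suc t) * (C * suc t)        ∎)
  where
  open ≤-Reasoning
  M = suc i * suc i
  t = √-num a i

-- Rounding down in the i-th approximation of the root costs at most C / (i + 1), which is at most ε
-- from `K` on.
≤√ : ∀ {N C a} → N * N ≤ C * C * a → fromℕ N ≤ℝ fromℕ C *ℝ √ℝ a
≤√ {N} {C} {a} h ε 0<ε = K , bound
  where
  K = proj₁ (archimedean-ε (ι C) 0<ε)
  C≤εK = proj₂ (archimedean-ε (ι C) 0<ε)
  bound : ∀ i → K ≤ i → ι N ℚ.≤ ι C ℚ.* √-approx a i ℚ.+ ε
  bound i K≤i = subst₂ ℚ._≤_ lhs rhs
    (ℚ.*-monoʳ-≤-nonNeg v {{ℚ.nonNegative (recip-nonNeg (0<ι i))}}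
      (ℚ.≤-trans
        (subst₂ ℚ._≤_ (ι-* N (suc i)) (trans (ι-* C (suc t)) (cong (ι C ℚ.*_) (ι-suc t)))
          (ι-mono (√-num-bound {N} {C} {a} i h)))
        (subst₂ ℚ._≤_ (sym (expand (ι C) (ι t))) refl (ℚ.+-monoʳ-≤ (ι C ℚ.* ι t) C≤εI))))
    where
    open +-*-Solver
    t = √-num a i
    I = ι (suc i)
    v = recip I
    C≤εI : ι C ℚ.≤ ε ℚ.* I
    C≤εI = ℚ.≤-trans C≤εK (ℚ.*-monoˡ-≤-nonNeg ε {{ℚ.nonNegative (ℚ.<⇒≤ 0<ε)}}
      (ι-mono (m≤n⇒m≤1+n K≤i)))
    expand : ∀ c t → c ℚ.* (t ℚ.+ 1ℚ) ≡ c ℚ.* t ℚ.+ c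
    expand = solve 2 (λ c t → c :* (t :+ con 1ℚ) := c :* t :+ c) refl
    lhs : ι N ℚ.* I ℚ.* v ≡ ι N
    lhs = mod₁ (ι N) (*-recip (0<ι i))
      (solve 3 (λ n i v → n :* i :* v := n :+ n :* (i :* v :- con 1ℚ)) refl (ι N) I v)
    rhs : (ι C ℚ.* ι t ℚ.+ ε ℚ.* I) ℚ.* v ≡ ι C ℚ.* (ι t ℚ.* v) ℚ.+ ε
    rhs = mod₁ ε (*-recip (0<ι i))
      (solve 5 (λ c t e i v → (c :* t :+ e :* i) :* v := c :* (t :* v) :+ e :+ e :* (i :* v :- con 1ℚ))
        refl (ι C) (ι t) ε I v)

-- log n ≤ n and log log n ≥ 1 - 1 / log n ≥ 1 / 101 hold for all approximations from the third on.
log/loglog≤ : ∀ {n k} (n≥3 : n ≥ 3) → n ≤ 8 * k →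
  fromℚ (ℤ.+ 1 ℚ./ 808) *ℝ (logℕ n n≥3 /ℝ loglogℕ n n≥3 [ 0<loglogℕ n n≥3 ]) ≤ℝ fromℕ k
log/loglog≤ {n} {k} n≥3 n≤8k ε 0<ε = 3 , λ i 3≤i → ℚ.≤-trans (bound i 3≤i)
  (ℚ.≤-trans (ℚ.≤-reflexive (sym (ℚ.+-identityʳ (ι k)))) (ℚ.+-monoʳ-≤ (ι k) (ℚ.<⇒≤ 0<ε)))
  where
  open +-*-Solver
  -- The bound for log 3 from `1<log3`. Its reciprocal is 100 / 101, which leaves 1 / 101 for the
  -- iterated logarithm; 808 is 101 times the 8 of n ≤ 8k.
  lower : ℚ
  lower = 1ℚ ℚ.+ ℤ.+ 1 ℚ./ 100
  0<n : 0ℚ ℚ.< ι n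
  0<n = ℚ.<-≤-trans (0<ι 2) (ι-mono n≥3)
  module _ (i : ℕ) (3≤i : 3 ≤ i) where
    x y : ℚ
    x = log-approx i (ι n)
    y = log-approx i x
    lower≤x : lower ℚ.≤ x
    lower≤x = ℚ.≤-trans (1<log3 i 3≤i) (log-approx-mono i (0<ι 2) (ι-mono n≥3))
    0<lower : 0ℚ ℚ.< lower
    0<lower = from-yes (0ℚ ℚ.<? lower)
    0<x : 0ℚ ℚ.< x
    0<x = ℚ.<-≤-trans 0<lower lower≤x
    x≤n : x ℚ.≤ ι n
    x≤n = ℚ.≤-trans (log-approx-upper i 0<n) (≤-diff 1ℚ 0≤1
      (solve 1 (λ n → n := n :- con 1ℚ :+ con 1ℚ) refl (ι n)))
    1/101≤y : ℤ.+ 1 ℚ./ 101 ℚ.≤ y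
    1/101≤y = ℚ.≤-trans (from-yes (ℤ.+ 1 ℚ./ 101 ℚ.≤? 1ℚ ℚ.- recip lower))
      (ℚ.≤-trans (ℚ.+-monoʳ-≤ 1ℚ (ℚ.neg-antimono-≤ (recip-anti 0<lower lower≤x)))
        (log-approx-lower i 0<x))
    0<1/101 : 0ℚ ℚ.< ℤ.+ 1 ℚ./ 101
    0<1/101 = from-yes (0ℚ ℚ.<? ℤ.+ 1 ℚ./ 101)
    1/y≤101 : recip y ℚ.≤ ι 101
    1/y≤101 = recip-anti 0<1/101 1/101≤y
    0≤1/808 : 0ℚ ℚ.≤ ℤ.+ 1 ℚ./ 808
    0≤1/808 = from-yes (0ℚ ℚ.≤? ℤ.+ 1 ℚ./ 808)
    bound : ℤ.+ 1 ℚ./ 808 ℚ.* (x ℚ.* recip y) ℚ.≤ ι k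
    bound = ℚ.≤-trans
      (ℚ.*-monoˡ-≤-nonNeg (ℤ.+ 1 ℚ./ 808) {{ℚ.nonNegative 0≤1/808}}
        (*-mono₂ (ℚ.<⇒≤ 0<x) (ℚ.≤-trans x≤n (ℚ.≤-trans (ι-mono n≤8k) (ℚ.≤-reflexive (ι-* 8 k))))
          (recip-nonNeg (ℚ.<-≤-trans 0<1/101 1/101≤y)) 1/y≤101))
      (ℚ.≤-reflexive (solve 1 (λ k → con (ℤ.+ 1 ℚ./ 808) :* ((con (ι 8) :* k) :* con (ι 101)) := k) refl (ι k)))

0<ℝfromℚ : ∀ {q} → 0ℚ ℚ.< q → 0ℝ <ℝ fromℚ q
0<ℝfromℚ {q} 0<q = q , 0<q , 0 , λ _ _ → ℚ.≤-reflexive (ℚ.+-identityˡ q)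

theorem5 : ∃[ c ] ∃[ C ] 0ℝ <ℝ c × 0ℝ <ℝ C ×
    ((n : ℕ) (n≥3 : n ≥ 3) →
    ∃[ k ] c *ℝ (logℕ n n≥3 /ℝ loglogℕ n n≥3 [ 0<loglogℕ n n≥3 ]) ≤ℝ fromℕ k × k ≤ n ×
    ((N : ℕ) → N ≥ 1 → (χ : Colouring N n) → ¬ MonochromaticSolution 12 9 χ →
    fromℕ N ≤ℝ C *ℝ √ℝ ((n ∸ k) !)))
theorem5 = let C , 1≤C , bound = square-bound in
  fromℚ (ℤ.+ 1 ℚ./ 808) , fromℕ C ,
  0<ℝfromℚ (from-yes (0ℚ ℚ.<? ℤ.+ 1 ℚ./ 808)) , 0<ℝfromℚ (ℚ.<-≤-trans 0<1 (ι-mono 1≤C)) ,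
  λ n n≥3 → let k , n≤8k , k≤n , N²≤ = bound n n≥3 in
    k , log/loglog≤ {k = k} n≥3 n≤8k , k≤n , λ N _ χ free → ≤√ {N} {C} (N²≤ N χ free)
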